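{- Let $u\in\{0\}\cup\mathbb N$, $m\in\mathbb N$, $D\subseteq\{0,1,\dots,\lfloor m/2\rfloor\}$, $E\subseteq\{0\}\cup\mathbb N$, and let $N$ be a subsemigroup of $(\mathbb N,+)$. Put $D_m=(D\cup(m-D))+m\mathbb Z$, $\pm N=N\cup(-N)$, $(\pm N)'=\pm N\cup\{0\}$, $\pm E=E\cup(-E)$. For each tuple $Q=(f,v,s,l,k,x)$ in the following list, the set $\mathcal R_Q=\{p\in\mathcal P^{\circ\bullet}\mid F(\{p\})\subseteq f,\ V(\{p\})\subseteq v,\ \Sigma(\{p\})\subseteq s,\ L(\{p\})\subseteq l,\ K(\{p\})\subseteq k,\ X(\{p\})\subseteq x\}$ is a non-hyperoctahedral category of two-colored partitions: 1. $(\{2\},\pm\{0,2\},2um\mathbb Z,m\mathbb Z,m\mathbb Z,\mathbb Z)$; 2. $(\{2\},\pm\{0,2\},2um\mathbb Z,m+2m\mathbb Z,2m\mathbb Z,\mathbb Z)$; 3. $(\{2\},\pm\{0,2\},2um\mathbb Z,m+2m\mathbb Z,2m\mathbb Z,\mathbb Z\setminus m\mathbb Z)$; 4. $(\{2\},\{0\},\{0\},\emptyset,m\mathbb Z,\mathbb Z)$; 5. $(\{2\},\pm\{0,2\},\{0\},\{0\},\{0\},\mathbb Z\setminus \pm N)$; 6. $(\{2\},\{0\},\{0\},\emptyset,\{0\},\mathbb Z\setminus\pm N)$; 7. $(\{2\},\{0\},\{0\},\emptyset,\{0\},\mathbb Z\setminus(\pm N)')$; 8. $(\{1,2\},\pm\{0,1,2\},um\mathbb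 Z,m\mathbb Z,m\mathbb Z,\mathbb Z\setminus D_m)$; 9. $(\{1,2\},\pm\{0,1,2\},2um\mathbb Z,m+2m\mathbb Z,2m\mathbb Z,\mathbb Z\setminus D_m)$; 10. $(\{1,2\},\pm\{0,1\},um\mathbb Z,\emptyset,m\mathbb Z,\mathbb Z\setminus D_m)$; 11. $(\{1,2\},\pm\{0,1,2\},\{0\},\{0\},\{0\},\mathbb Z\setminus\pm E)$; 12. $(\{1,2\},\pm\{0,1\},\{0\},\emptyset,\{0\},\mathbb Z\setminus\pm E)$; 13. $(\mathbb N,\mathbb Z,um\mathbb Z,m\mathbb Z,m\mathbb Z,\mathbb Z\setminus D_m)$; 14. $(\mathbb N,\mathbb Z,\{0\},\{0\},\{0\},\mathbb Z\setminus\pm E)$.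
   Context: A two-colored partition $p$ consists of a lower row $R_L$ and an upper row $R_U$ (disjoint, possibly empty, finite totally ordered sets), a decomposition of $P_p=R_L\cup R_U$ into disjoint nonempty blocks, and a coloring of each point by $\circ$ or $\bullet$; $\mathcal P^{\circ\bullet}$ is the set of all such. Orientation: the cyclic order on $P_p$ agreeing with the order of $R_L$ on $R_L$, with the reverse order of $R_U$ on $R_U$, with the maximum of $R_U$ succeeding the maximum of $R_L$ and the minimum of $R_L$ succeeding the minimum of $R_U$; intervals $]\alpha,\beta[_p$, $]\alpha,\beta]_p$ for distinct $\alpha,\beta$ refer to this cyclic order. Normalized color: color for lower points, inverse color for upper points. $\sigma_p(S)$: number of normalized-white minus number of normalized-black points of $S$; $\Sigma(p)=\sigma_p(P_p)$. Color distance: $\delta_p(\alpha,\alpha)=\Sigma(p)$; for $\alpha\ne\beta$, $\delta_p(\alpha,\beta)=\sigma_p(]\alpha,\beta[_p)$ if their normalized colors differ and $\sigma_p(]\alpha,\beta]_p)$ if they agree. Blocks $B\neq B'$ cross if there are pairwise distinct $\alpha,\beta\in B$, $\alpha',\beta'\in B'$ appearing in the cyclic order in the order $\alpha,\alpha',\beta,\beta'$. For a set $\mathcal S$ of partitions: $F(\mathcal S)=\{|B|: p\in\mathcal S, B$ block of $p\}$; $V(\mathcal S)=\{\sigma_p(B): p\in\mathcal S,B$ block of $p\}$; $\Sigma(\mathcal S)=\{\Sigma(p):p\in\mathcal S\}$; $L(\mathcal S)$ (resp. $K(\mathcal S)$) is the set of $\delta_p(\alpha_1,\alpha_2)$ over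 $p\in\mathcal S$, blocks $B$ of $p$, $\alpha_1\neq\alpha_2\in B$ with $]\alpha_1,\alpha_2[_p\cap B=\emptyset$ and $\sigma_p(\{\alpha_1,\alpha_2\})\neq0$ (resp. $=0$); $X(\mathcal S)$ is the set of $\delta_p(\alpha_1,\alpha_2)$ over $p\in\mathcal S$, crossing blocks $B_1,B_2$ of $p$, $\alpha_1\in B_1,\alpha_2\in B_2$. Set notation: $xA+yB=\{xa+yb\}$, $\pm S=S\cup(-S)$, $\mathbb N=\{1,2,\dots\}$. Category: A set $\mathcal C\subseteq\mathcal P^{\circ\bullet}$ is a category if it contains the empty partition, the two partitions with one lower and one upper point of the same color ($\circ$ or $\bullet$) forming one block, and the two partitions without upper points having two lower points colored $\bullet\circ$ resp. $\circ\bullet$ forming one block, and is closed under: tensor product (append the rows of the second partition to the right of those of the first); involution (exchange upper and lower rows); and composition $pp'$ of pairs $(p,p')$ where the upper row of $p$ and lower row of $p'$ have equal length and equal colors rank by rank, defined by taking the lower row of $p$ and the upper row of $p'$ as rows, identifying the upper row of $p$ with the lower row of $p'$, and letting the blocks be the nonempty intersections with the new point set of the classes of the equivalence relation generated by the blocks of $p$ and of $p'$. A category $\mathcal C$ is non-hyperoctahedral if it contains the partition without upper points whose two lower points are colored $\circ,\bullet$ (left to right) and are singleton blocks, or it does not contain the partition without upper points whose four lower points are colored $\circ,\bullet,\circ,\bullet$ and form a single block. -}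

module Defs where

open import Data.Nat as ℕ using (ℕ; zero; suc; _≤_; _<ᵇ_; _≡ᵇ_)
open import Data.Nat.DivMod using (_/_)
open import Data.Fin using (Fin; toℕ; splitAt)
open import Data.Integer as ℤ using (ℤ; +_; -_; 0ℤ; 1ℤ; -1ℤ)
open import Data.Bool using (Bool; true; false; if_then_else_; _∧_; _∨_; not)
open import Data.List using (List; map; _++_; foldr; allFin)
open import Data.Sum using (_⊎_; inj₁; inj₂; [_,_])
open import Data.Product using (Σ; ∃; ∃-syntax; _×_; _,_)
open import Data.Empty using (⊥)
open import Data.Unit using (⊤)
open import Relation.Nullary using (¬_)
open import Relation.Binary.PropositionalEquality using (_≡_)
open import Relation.Binary.Construct.Closure.ReflexiveTransitive using (Star)

-- Two-colored partitions.
-- A partition with k lower and l upper points.  Lower point i is inj₁ i,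
-- upper point j is inj₂ j (rows ordered left to right by Fin order).
-- Blocks are given by a labelling: two points lie in the same block iff
-- they carry the same label (labels themselves are irrelevant).

data Color : Set where
  white black : Color

inv : Color → Color
inv white = black
inv black = white

Pt : ℕ → ℕ → Set
Pt k l = Fin k ⊎ Fin l

record Part (k l : ℕ) : Set where
  field
    col : Pt k l → Color
    blk : Pt k l → ℕ
open Part public

allPts : ∀ k l → List (Pt k l)
allPts k l = map inj₁ (allFin k) ++ map inj₂ (allFin l)

module _ {k l : ℕ} (p : Part k l) where

  ncol : Pt k l → Color
  ncol (inj₁ i) = col p (inj₁ i)
  ncol (inj₂ j) = inv (col p (inj₂ j))

  wt : Pt k l → ℤ
  wt α with ncol α
  ... | white = 1ℤ
  ... | black = -1ℤ

  -- position in the cyclic order: lower row left to right, then upper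
  -- row right to left, then back to the start.
  pos : Pt k l → ℕ
  pos (inj₁ i) = toℕ i
  pos (inj₂ j) = k ℕ.+ (l ℕ.∸ suc (toℕ j))

  -- γ ∈ ]α,β[_p   (for α ≠ β)
  inOpen : Pt k l → Pt k l → Pt k l → Bool
  inOpen α β γ =
    let a = pos α ; b = pos β ; c = pos γ in
    if a <ᵇ b then (a <ᵇ c) ∧ (c <ᵇ b) else ((a <ᵇ c) ∨ (c <ᵇ b))

  -- γ ∈ ]α,β]_p   (for α ≠ β)
  inHalf : Pt k l → Pt k l → Pt k l → Bool
  inHalf α β γ = inOpen α β γ ∨ (pos γ ≡ᵇ pos β)

  σ : (Pt k l → Bool) → ℤ
  σ S = foldr (λ γ acc → (if S γ then wt γ else 0ℤ) ℤ.+ acc) 0ℤ (allPts k l)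

  card : (Pt k l → Bool) → ℕ
  card S = foldr (λ γ acc → (if S γ then 1 else 0) ℕ.+ acc) 0 (allPts k l)

  Σp : ℤ
  Σp = σ (λ _ → true)

  blockOf : Pt k l → Pt k l → Bool
  blockOf α γ = blk p γ ≡ᵇ blk p α

  sameNcol : Pt k l → Pt k l → Bool
  sameNcol α β with ncol α | ncol β
  ... | white | white = true
  ... | black | black = true
  ... | _     | _     = false

  δ : Pt k l → Pt k l → ℤ
  δ α β = if pos α ≡ᵇ pos β then Σp
          else (if sameNcol α β then σ (inHalf α β) else σ (inOpen α β))

  Crossing : Pt k l → Pt k l → Set
  Crossing α₁ α₂ =
    ¬ blk p α₁ ≡ blk p α₂ ×
    ∃[ α ] ∃[ β ] ∃[ α' ] ∃[ β' ]
      (blk p α ≡ blk p α₁ × blk p β ≡ blk p α₁ × ¬ α ≡ β ×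
       blk p α' ≡ blk p α₂ × blk p β' ≡ blk p α₂ × ¬ α' ≡ β' ×
       inOpen α β α' ≡ true × inOpen β α β' ≡ true)

  Consecutive : Pt k l → Pt k l → Set
  Consecutive α₁ α₂ =
    blk p α₁ ≡ blk p α₂ × ¬ α₁ ≡ α₂ ×
    (∀ γ → inOpen α₁ α₂ γ ≡ true → ¬ blk p γ ≡ blk p α₁)

  FSub : (ℕ → Set) → Set
  FSub f = ∀ α → f (card (blockOf α))

  VSub : (ℤ → Set) → Set
  VSub v = ∀ α → v (σ (blockOf α))

  SSub : (ℤ → Set) → Set
  SSub s = s Σp

  LSub : (ℤ → Set) → Set
  LSub L = ∀ α₁ α₂ → Consecutive α₁ α₂ → ¬ (wt α₁ ℤ.+ wt α₂ ≡ 0ℤ) → L (δ α₁ α₂)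

  KSub : (ℤ → Set) → Set
  KSub K = ∀ α₁ α₂ → Consecutive α₁ α₂ → wt α₁ ℤ.+ wt α₂ ≡ 0ℤ → K (δ α₁ α₂)

  XSub : (ℤ → Set) → Set
  XSub X = ∀ α₁ α₂ → Crossing α₁ α₂ → X (δ α₁ α₂)

emptyP : Part 0 0
emptyP = record { col = λ { (inj₁ ()) ; (inj₂ ()) } ; blk = λ _ → 0 }

idP : Color → Part 1 1
idP c = record { col = λ _ → c ; blk = λ _ → 0 }

pairP : Color → Color → Part 2 0
pairP c₁ c₂ = record { col = cl ; blk = λ _ → 0 }
  where
  cl : Pt 2 0 → Color
  cl (inj₁ Fin.zero) = c₁
  cl (inj₁ (Fin.suc _)) = c₂
  cl (inj₂ ())

singP : Part 2 0
singP = record { col = cl ; blk = bl }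
  where
  cl : Pt 2 0 → Color
  cl (inj₁ Fin.zero) = white
  cl (inj₁ (Fin.suc _)) = black
  cl (inj₂ ())
  bl : Pt 2 0 → ℕ
  bl (inj₁ Fin.zero) = 0
  bl (inj₁ (Fin.suc _)) = 1
  bl (inj₂ ())

fourP : Part 4 0
fourP = record { col = cl ; blk = λ _ → 0 }
  where
  cl : Pt 4 0 → Color
  cl (inj₁ Fin.zero) = white
  cl (inj₁ (Fin.suc Fin.zero)) = black
  cl (inj₁ (Fin.suc (Fin.suc Fin.zero))) = white
  cl (inj₁ (Fin.suc (Fin.suc (Fin.suc _)))) = black
  cl (inj₂ ())

-- tensor product (labels of p made even, labels of q made odd, so that
-- blocks of p and q stay distinct)
_⊗_ : ∀ {k l k' l'} → Part k l → Part k' l' → Part (k ℕ.+ k') (l ℕ.+ l')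
_⊗_ {k} {l} {k'} {l'} p q = record { col = cl ; blk = bl }
  where
  cl : Pt (k ℕ.+ k') (l ℕ.+ l') → Color
  cl (inj₁ i) = [ (λ a → col p (inj₁ a)) , (λ b → col q (inj₁ b)) ] (splitAt k i)
  cl (inj₂ j) = [ (λ a → col p (inj₂ a)) , (λ b → col q (inj₂ b)) ] (splitAt l j)
  bl : Pt (k ℕ.+ k') (l ℕ.+ l') → ℕ
  bl (inj₁ i) = [ (λ a → 2 ℕ.* blk p (inj₁ a)) , (λ b → suc (2 ℕ.* blk q (inj₁ b))) ] (splitAt k i)
  bl (inj₂ j) = [ (λ a → 2 ℕ.* blk p (inj₂ a)) , (λ b → suc (2 ℕ.* blk q (inj₂ b))) ] (splitAt l j)

swapPt : ∀ {k l} → Pt l k → Pt k l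
swapPt (inj₁ i) = inj₂ i
swapPt (inj₂ j) = inj₁ j

_* : ∀ {k l} → Part k l → Part l k
p * = record { col = λ α → col p (swapPt α) ; blk = λ α → blk p (swapPt α) }

-- Composition.  p : Part k l, q : Part l n; the upper row of p is
-- identified with the lower row of q.  Combined point set:
Pt3 : ℕ → ℕ → ℕ → Set
Pt3 k l n = Fin k ⊎ (Fin l ⊎ Fin n)

embP : ∀ {k l n} → Pt k l → Pt3 k l n
embP (inj₁ a) = inj₁ a
embP (inj₂ b) = inj₂ (inj₁ b)

embQ : ∀ {k l n} → Pt l n → Pt3 k l n
embQ (inj₁ b) = inj₂ (inj₁ b)
embQ (inj₂ c) = inj₂ (inj₂ c)

embR : ∀ {k l n} → Pt k n → Pt3 k l n
embR (inj₁ a) = inj₁ a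
embR (inj₂ c) = inj₂ (inj₂ c)

data CompEdge {k l n} (p : Part k l) (q : Part l n) : Pt3 k l n → Pt3 k l n → Set where
  viaP : ∀ a b → blk p a ≡ blk p b → CompEdge p q (embP a) (embP b)
  viaQ : ∀ a b → blk q a ≡ blk q b → CompEdge p q (embQ a) (embQ b)

Composable : ∀ {k l n} → Part k l → Part l n → Set
Composable p q = ∀ j → col p (inj₂ j) ≡ col q (inj₁ j)

IsComposition : ∀ {k l n} → Part k l → Part l n → Part k n → Set
IsComposition p q r =
  (∀ a → col r (inj₁ a) ≡ col p (inj₁ a)) ×
  (∀ c → col r (inj₂ c) ≡ col q (inj₂ c)) ×
  (∀ x y → (blk r x ≡ blk r y → Star (CompEdge p q) (embR x) (embR y)) ×
           (Star (CompEdge p q) (embR x) (embR y) → blk r x ≡ blk r y))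

PartPred : Set₁
PartPred = ∀ {k l} → Part k l → Set

record IsCategory (C : PartPred) : Set where
  field
    hasEmpty  : C emptyP
    hasIdW    : C (idP white)
    hasIdB    : C (idP black)
    hasPairBW : C (pairP black white)
    hasPairWB : C (pairP white black)
    tensorClosed : ∀ {k l k' l'} (p : Part k l) (q : Part k' l') → C p → C q → C (p ⊗ q)
    involClosed  : ∀ {k l} (p : Part k l) → C p → C (p *)
    compClosed   : ∀ {k l n} (p : Part k l) (q : Part l n) (r : Part k n) →
                   Composable p q → IsComposition p q r → C p → C q → C r

NonHyperoctahedral : PartPred → Set
NonHyperoctahedral C = C singP ⊎ ¬ C fourP

IsNonHyperoctahedralCategory : PartPred → Set
IsNonHyperoctahedralCategory C = IsCategory C × NonHyperoctahedral C

record Tuple : Set₁ where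
  field
    fS : ℕ → Set
    vS sS lS kS xS : ℤ → Set

R : Tuple → PartPred
R Q p = FSub p (Tuple.fS Q) × VSub p (Tuple.vS Q) × SSub p (Tuple.sS Q) ×
        LSub p (Tuple.lS Q) × KSub p (Tuple.kS Q) × XSub p (Tuple.xS Q)

aℤ : ℤ → ℤ → Set
aℤ a z = ∃[ t ] z ≡ a ℤ.* t

shiftℤ : ℤ → ℤ → ℤ → Set
shiftℤ b a z = ∃[ t ] z ≡ b ℤ.+ a ℤ.* t

allℤ : ℤ → Set
allℤ _ = ⊤

noneℤ : ℤ → Set
noneℤ _ = ⊥

zeroℤ : ℤ → Set
zeroℤ z = z ≡ 0ℤ

pm01 pm02 pm012 : ℤ → Set
pm01 z = z ≡ 0ℤ ⊎ z ≡ + 1 ⊎ z ≡ - + 1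
pm02 z = z ≡ 0ℤ ⊎ z ≡ + 2 ⊎ z ≡ - + 2
pm012 z = z ≡ 0ℤ ⊎ z ≡ + 1 ⊎ z ≡ - + 1 ⊎ z ≡ + 2 ⊎ z ≡ - + 2

pmSet : (ℕ → Set) → ℤ → Set
pmSet A z = ∃[ n ] (A n × (z ≡ + n ⊎ z ≡ - + n))

pmSet' : (ℕ → Set) → ℤ → Set
pmSet' A z = pmSet A z ⊎ z ≡ 0ℤ

Dm : ℕ → (ℕ → Set) → ℤ → Set
Dm m D z = ∃[ d ] (D d × ∃[ t ] (z ≡ + d ℤ.+ + m ℤ.* t ⊎ z ≡ (+ m ℤ.- + d) ℤ.+ + m ℤ.* t))

compl : (ℤ → Set) → ℤ → Set
compl A z = ¬ A z

only2 : ℕ → Set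
only2 n = n ≡ 2

one2 : ℕ → Set
one2 n = n ≡ 1 ⊎ n ≡ 2

posℕ : ℕ → Set
posℕ n = 1 ≤ n

mkT : (ℕ → Set) → (ℤ → Set) → (ℤ → Set) → (ℤ → Set) → (ℤ → Set) → (ℤ → Set) → Tuple
mkT f v s l k x = record { fS = f ; vS = v ; sS = s ; lS = l ; kS = k ; xS = x }

-- The fourteen tuples of the theorem (index 1..14 ↦ Fin 0..13),
-- for parameters u, m, D, E, N.
tuples : (u m : ℕ) (D E N : ℕ → Set) → Fin 14 → Tuple
tuples u m D E N i = go (toℕ i)
  where
  mZ = + m
  2mZ = + (2 ℕ.* m)
  umZ = + (u ℕ.* m)
  2umZ = + (2 ℕ.* u ℕ.* m)
  go : ℕ → Tuple
  go 0  = mkT only2 pm02 (aℤ 2umZ) (aℤ mZ) (aℤ mZ) allℤ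
  go 1  = mkT only2 pm02 (aℤ 2umZ) (shiftℤ mZ 2mZ) (aℤ 2mZ) allℤ
  go 2  = mkT only2 pm02 (aℤ 2umZ) (shiftℤ mZ 2mZ) (aℤ 2mZ) (compl (aℤ mZ))
  go 3  = mkT only2 zeroℤ zeroℤ noneℤ (aℤ mZ) allℤ
  go 4  = mkT only2 pm02 zeroℤ zeroℤ zeroℤ (compl (pmSet N))
  go 5  = mkT only2 zeroℤ zeroℤ noneℤ zeroℤ (compl (pmSet N))
  go 6  = mkT only2 zeroℤ zeroℤ noneℤ zeroℤ (compl (pmSet' N))
  go 7  = mkT one2 pm012 (aℤ umZ) (aℤ mZ) (aℤ mZ) (compl (Dm m D))
  go 8  = mkT one2 pm012 (aℤ 2umZ) (shiftℤ mZ 2mZ) (aℤ 2mZ) (compl (Dm m D))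
  go 9  = mkT one2 pm01 (aℤ umZ) noneℤ (aℤ mZ) (compl (Dm m D))
  go 10 = mkT one2 pm012 zeroℤ zeroℤ zeroℤ (compl (pmSet E))
  go 11 = mkT one2 pm01 zeroℤ noneℤ zeroℤ (compl (pmSet E))
  go 12 = mkT posℕ allℤ (aℤ umZ) (aℤ mZ) (aℤ mZ) (compl (Dm m D))
  go _  = mkT posℕ allℤ zeroℤ zeroℤ zeroℤ (compl (pmSet E))

{-# OPTIONS --safe #-}

-- Read the normalized colours along the circle as a walk with steps ±1 and let the
-- height of a point be the lower end of its step.  Then δ(α, β) is the difference of
-- heights modulo Σ(p), so L, K and X constrain the heights of points of one block and of
-- crossing blocks.  Composition is a tensor product followed by erasing turns, i.e.
-- adjacent points of opposite normalized colour (hence of equal height), whose blocks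
-- are merged.  Erasing a turn preserves every constraint: a block of size ≤ 2 merges
-- with another into one of size ≤ 2, height differences add up along the merged block,
-- and a chord through the turn crosses another chord only if one of its halves does.
-- All that is used of the fourteen tuples is closure of the sets s, l, k, x under
-- certain sums.

module Submission where

open import Defs
open import Data.Nat as ℕ using (ℕ; zero; suc; _≤_; _<_; _+_; _∸_; _<ᵇ_; _≡ᵇ_; z≤n; s≤s)
open import Data.Nat.DivMod using (_/_)
open import Data.Nat.Properties as ℕₚ using (_<?_; _≟_; <-cmp)
open import Data.Fin using (Fin; zero; suc; toℕ; fromℕ<; splitAt; _↑ˡ_; _↑ʳ_)
open import Data.Fin.Properties as Finₚ using (toℕ-injective; toℕ<n)
open import Data.Integer as ℤ using (ℤ; +_; -_; 0ℤ; 1ℤ; -1ℤ)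
open import Data.Integer.Properties as ℤₚ using ()
open import Data.Integer.Tactic.RingSolver using (solve-∀)
open import Data.Bool using (Bool; true; false; if_then_else_; _∧_; _∨_; not; _xor_)
open import Data.Bool.Properties as Boolₚ using (xor-comm; xor-same)
open import Data.Bool.Solver using (module xor-∧-Solver)
open import Data.List using (List; []; _∷_; map; _++_; foldr; allFin; tabulate; length; filter)
open import Data.List.Membership.Propositional using (_∈_)
open import Data.List.Membership.Propositional.Properties
  using (∈-filter⁺; ∈-filter⁻; ∈-allFin; ∈-map⁺; ∈-map⁻; ∈-++⁺ˡ; ∈-++⁺ʳ)
open import Data.List.Properties using (map-tabulate)
open import Data.List.Relation.Unary.All as All using ()
open import Data.List.Relation.Unary.AllPairs using ([]; _∷_)
open import Data.List.Relation.Unary.Any using (here; there)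
open import Data.List.Relation.Unary.Unique.Propositional using (Unique)
open import Data.List.Relation.Unary.Unique.Propositional.Properties as Uniqueₚ using ()
open import Data.Sum using (_⊎_; inj₁; inj₂; [_,_])
open import Data.Sum.Properties using (inj₁-injective; inj₂-injective)
open import Data.Product using (∃; ∃-syntax; _×_; _,_; proj₁; proj₂)
open import Data.Empty using (⊥; ⊥-elim)
open import Data.Unit using (⊤; tt)
open import Function using (_∘_; id)
open import Function.Bundles using (mk⇔)
open import Relation.Nullary using (¬_; ¬?; Dec; yes; no; contradiction)
open import Relation.Nullary.Decidable using (_×-dec_; dec-true; dec-false; does-⇔)
open import Relation.Binary.Definitions using (tri<; tri≈; tri>)
open import Relation.Binary.PropositionalEquality
  using (_≡_; _≢_; refl; sym; trans; cong; cong₂; subst; module ≡-Reasoning)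
open import Relation.Binary.Construct.Closure.ReflexiveTransitive using (Star; ε; _◅_; _◅◅_)

-- `L` and `K` speak of consecutive points of a block, and merging blocks changes which points are
-- consecutive. The invariant carried through the operations therefore speaks of all pairs of points
-- of a block. For blocks of size at most two this is the same condition. For arbitrary blocks it
-- follows because `l` and `k` coincide there, so that differences add up regardless of colours.
--
-- The condition on `V` is not carried along but recovered: a block of size one has sum 1 or -1, a
-- block of size two has sum 0 or, if its normalized colours agree, 2 or -2, which requires `l` to
-- be inhabited. For arbitrary blocks `v` is all of ℤ.
--
-- Crossing is expressed as a sum modulo 2 of four order comparisons. Cutting a chord at a turn then
-- becomes an identity between such sums, without a case distinction on the positions of the points.
-- Colours follow a similar parity: a turn flips the normalized colour, so `k` and `l` behave like
-- the even and the odd part of a grading.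

-- Boolean comparison of natural numbers

<ᵇ-true : ∀ {m n} → m < n → (m <ᵇ n) ≡ true
<ᵇ-true {m} {n} = dec-true (m <? n)

<ᵇ-false : ∀ {m n} → n ≤ m → (m <ᵇ n) ≡ false
<ᵇ-false {m} {n} n≤m = dec-false (m <? n) (ℕₚ.≤⇒≯ n≤m)

<ᵇ-cong : ∀ {m n m′ n′} → (m < n → m′ < n′) → (m′ < n′ → m < n) → (m <ᵇ n) ≡ (m′ <ᵇ n′)
<ᵇ-cong {m} {n} {m′} {n′} to from = does-⇔ (mk⇔ to from) (m <? n) (m′ <? n′)

<ᵇ-swap : ∀ {m n} → m ≢ n → (m <ᵇ n) ≡ not (n <ᵇ m)
<ᵇ-swap {m} {n} m≢n with <-cmp m n
... | tri< m<n _ _ rewrite <ᵇ-true m<n | <ᵇ-false (ℕₚ.<⇒≤ m<n) = refl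
... | tri≈ _ m≡n _ = contradiction m≡n m≢n
... | tri> _ _ n<m rewrite <ᵇ-true n<m | <ᵇ-false (ℕₚ.<⇒≤ n<m) = refl

≡ᵇ-false : ∀ {m n} → m ≢ n → (m ≡ᵇ n) ≡ false
≡ᵇ-false {m} {n} = dec-false (m ≟ n)

<ᵇ-∨-≡ᵇ : ∀ m n → (m <ᵇ n) ∨ (m ≡ᵇ n) ≡ (m <ᵇ suc n)
<ᵇ-∨-≡ᵇ zero    zero    = refl
<ᵇ-∨-≡ᵇ zero    (suc n) = refl
<ᵇ-∨-≡ᵇ (suc m) zero    = refl
<ᵇ-∨-≡ᵇ (suc m) (suc n) = <ᵇ-∨-≡ᵇ m n

-- Heights

weight : Color → ℤ
weight white = 1ℤ
weight black = -1ℤ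

inv-inv : ∀ c → inv (inv c) ≡ c
inv-inv white = refl
inv-inv black = refl

weight-inv : ∀ c → weight (inv c) ≡ - weight c
weight-inv white = refl
weight-inv black = refl

sumFin : ∀ {n} → (Fin n → ℤ) → ℤ
sumFin {zero}  f = 0ℤ
sumFin {suc n} f = f zero ℤ.+ sumFin (f ∘ suc)

sumFin-cong : ∀ {n} {f g : Fin n → ℤ} → (∀ i → f i ≡ g i) → sumFin f ≡ sumFin g
sumFin-cong {zero}  f≗g = refl
sumFin-cong {suc n} f≗g = cong₂ ℤ._+_ (f≗g zero) (sumFin-cong (f≗g ∘ suc))

sumFin-0 : ∀ {n} {f : Fin n → ℤ} → (∀ i → f i ≡ 0ℤ) → sumFin f ≡ 0ℤ
sumFin-0 {zero}  f≗0 = refl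
sumFin-0 {suc n} f≗0 = cong₂ ℤ._+_ (f≗0 zero) (sumFin-0 (f≗0 ∘ suc))

sumFin-- : ∀ {n} (f g : Fin n → ℤ) → sumFin (λ i → f i ℤ.- g i) ≡ sumFin f ℤ.- sumFin g
sumFin-- {zero}  f g = refl
sumFin-- {suc n} f g rewrite sumFin-- (f ∘ suc) (g ∘ suc) =
  interchange (f zero) (g zero) (sumFin (f ∘ suc)) (sumFin (g ∘ suc))
  where
  interchange : ∀ a b c d → (a ℤ.- b) ℤ.+ (c ℤ.- d) ≡ (a ℤ.+ c) ℤ.- (b ℤ.+ d)
  interchange = solve-∀

prefix : ∀ {n} → (Fin n → Color) → ℕ → ℤ
prefix c t = sumFin (λ i → if toℕ i <ᵇ t then weight (c i) else 0ℤ)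

total : ∀ {n} → (Fin n → Color) → ℤ
total {n} c = prefix c n

total-sum : ∀ {n} (c : Fin n → Color) → total c ≡ sumFin (weight ∘ c)
total-sum c = sumFin-cong (λ i → cong (λ b → if b then weight (c i) else 0ℤ) (<ᵇ-true (toℕ<n i)))

prefix-cong : ∀ {n} {c d : Fin n → Color} → (∀ i → c i ≡ d i) → ∀ t → prefix c t ≡ prefix d t
prefix-cong c≗d t = sumFin-cong (λ i → cong (λ x → if toℕ i <ᵇ t then weight x else 0ℤ) (c≗d i))

prefix-0 : ∀ {n} (c : Fin n → Color) → prefix c 0 ≡ 0ℤ
prefix-0 {n} c = sumFin-0 {n} {λ _ → 0ℤ} (λ _ → refl)

prefix-suc : ∀ {n} (c : Fin n → Color) i → prefix c (suc (toℕ i)) ≡ prefix c (toℕ i) ℤ.+ weight (c i)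
prefix-suc c zero    rewrite prefix-0 (c ∘ suc) =
  trans (ℤₚ.+-identityʳ (weight (c zero))) (sym (ℤₚ.+-identityˡ (weight (c zero))))
prefix-suc c (suc i) rewrite prefix-suc (c ∘ suc) i =
  sym (ℤₚ.+-assoc (weight (c zero)) (prefix (c ∘ suc) (toℕ i)) (weight (c (suc i))))

-- Written with `splitAt` so that the rows of `p ⊗ q` have this form by computation.
_⧺_ : ∀ {m n} → (Fin m → Color) → (Fin n → Color) → Fin (m + n) → Color
_⧺_ {m} c d i = [ c , d ] (splitAt m i)

⧺-suc : ∀ {m n} (c : Fin (suc m) → Color) (d : Fin n → Color) i → (c ⧺ d) (suc i) ≡ ((c ∘ suc) ⧺ d) i
⧺-suc {m} c d i with splitAt m i
... | inj₁ _ = refl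
... | inj₂ _ = refl

prefix-⧺ˡ : ∀ {m n} (c : Fin m → Color) (d : Fin n → Color) {t} → t ≤ m → prefix (c ⧺ d) t ≡ prefix c t
prefix-⧺ˡ {zero}  c d {zero} _ = prefix-0 d
prefix-⧺ˡ {suc m} c d {zero} _ = trans (prefix-0 (c ⧺ d)) (sym (prefix-0 c))
prefix-⧺ˡ {suc m} c d {suc t} (s≤s t≤m) =
  cong (ℤ._+_ (weight (c zero))) (trans (prefix-cong (⧺-suc c d) t) (prefix-⧺ˡ (c ∘ suc) d t≤m))

prefix-⧺ʳ : ∀ {m n} (c : Fin m → Color) (d : Fin n → Color) t →
            prefix (c ⧺ d) (m + t) ≡ total c ℤ.+ prefix d t
prefix-⧺ʳ {zero}  c d t = sym (ℤₚ.+-identityˡ _)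
prefix-⧺ʳ {suc m} c d t =
  trans (cong (ℤ._+_ (weight (c zero)))
          (trans (prefix-cong (⧺-suc c d) (m + t)) (prefix-⧺ʳ (c ∘ suc) d t)))
        (sym (ℤₚ.+-assoc (weight (c zero)) (total (c ∘ suc)) (prefix d t)))

total-⧺ : ∀ {m n} (c : Fin m → Color) (d : Fin n → Color) → total (c ⧺ d) ≡ total c ℤ.+ total d
total-⧺ {m} {n} c d = prefix-⧺ʳ c d n

-- The index of the lower end of step `t`: a white step rises from it, a black step falls to it.
lift : Color → ℕ → ℕ
lift white t = t
lift black t = suc t

-- A row is read as a walk with unit steps; a point is the step it stands for,
-- and its height is the lower end of that step.
height : ∀ {n} → (Fin n → Color) → Fin n → ℤ
height c i = prefix c (lift (c i) (toℕ i))

-- With the inverted colour, `lift` picks the other end of the step.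
height-top : ∀ {n} (c : Fin n → Color) i → prefix c (lift (inv (c i)) (toℕ i)) ≡ height c i ℤ.+ 1ℤ
height-top c i = top (c i) refl
  where
  cancel : ∀ a → a ≡ (a ℤ.+ -1ℤ) ℤ.+ 1ℤ
  cancel = solve-∀
  step : ∀ {x} → c i ≡ x → prefix c (suc (toℕ i)) ≡ prefix c (toℕ i) ℤ.+ weight x
  step refl = prefix-suc c i
  top : ∀ x → c i ≡ x → prefix c (lift (inv x) (toℕ i)) ≡ prefix c (lift x (toℕ i)) ℤ.+ 1ℤ
  top white ci = step ci
  top black ci = trans (cancel (prefix c (toℕ i))) (cong (ℤ._+ 1ℤ) (sym (step ci)))

height-cong : ∀ {n} {c d : Fin n → Color} → (∀ i → c i ≡ d i) → ∀ i → height c i ≡ height d i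
height-cong {d = d} c≗d i rewrite c≗d i = prefix-cong c≗d (lift (d i) (toℕ i))

toℕ-splitAtˡ : ∀ m {n} (i : Fin (m + n)) {a} → splitAt m i ≡ inj₁ a → toℕ i ≡ toℕ a
toℕ-splitAtˡ m {n} i {a} eq = trans (cong toℕ (sym (Finₚ.splitAt⁻¹-↑ˡ eq))) (Finₚ.toℕ-↑ˡ a n)

toℕ-splitAtʳ : ∀ m {n} (i : Fin (m + n)) {b} → splitAt m i ≡ inj₂ b → toℕ i ≡ m + toℕ b
toℕ-splitAtʳ m i {b} eq = trans (cong toℕ (sym (Finₚ.splitAt⁻¹-↑ʳ eq))) (Finₚ.toℕ-↑ʳ m b)

lift-≤ : ∀ x {t m} → t < m → lift x t ≤ m
lift-≤ white t<m = ℕₚ.<⇒≤ t<m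
lift-≤ black t<m = t<m

lift-+ : ∀ x m t → lift x (m + t) ≡ m + lift x t
lift-+ white m t = refl
lift-+ black m t = sym (ℕₚ.+-suc m t)

height-⧺ˡ : ∀ {m n} (c : Fin m → Color) (d : Fin n → Color) i {a} →
            splitAt m i ≡ inj₁ a → height (c ⧺ d) i ≡ height c a
height-⧺ˡ {m} c d i {a} eq = trans
  (cong₂ (λ s t → prefix (c ⧺ d) (lift ([ c , d ] s) t)) eq (toℕ-splitAtˡ m i eq))
  (prefix-⧺ˡ c d (lift-≤ (c a) (toℕ<n a)))

height-⧺ʳ : ∀ {m n} (c : Fin m → Color) (d : Fin n → Color) i {b} →
            splitAt m i ≡ inj₂ b → height (c ⧺ d) i ≡ total c ℤ.+ height d b
height-⧺ʳ {m} c d i {b} eq = trans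
  (cong₂ (λ s t → prefix (c ⧺ d) (lift ([ c , d ] s) t)) eq (toℕ-splitAtʳ m i eq))
  (trans (cong (prefix (c ⧺ d)) (lift-+ (d b) m (toℕ b)))
         (prefix-⧺ʳ c d (lift (d b) (toℕ b))))

-- The linear order of the points around the circle

before : ∀ {k l} → Pt k l → Pt k l → Bool
before (inj₁ i) (inj₁ j) = toℕ i <ᵇ toℕ j
before (inj₁ i) (inj₂ j) = true
before (inj₂ i) (inj₁ j) = false
before (inj₂ i) (inj₂ j) = toℕ j <ᵇ toℕ i

∸-suc-reflects-< : ∀ {l i j} → j < l → l ∸ suc i < l ∸ suc j → j < i
∸-suc-reflects-< {l} {i} {j} j<l lt with j <? i
... | yes j<i = j<i
... | no j≮i  = contradiction (ℕₚ.∸-monoʳ-≤ l (s≤s (ℕₚ.≮⇒≥ j≮i))) (ℕₚ.<⇒≱ lt)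

pos-before : ∀ {k l} (p : Part k l) α β → (pos p α <ᵇ pos p β) ≡ before α β
pos-before p (inj₁ i) (inj₁ j) = refl
pos-before p (inj₁ i) (inj₂ j) = <ᵇ-true (ℕₚ.≤-trans (toℕ<n i) (ℕₚ.m≤m+n _ _))
pos-before p (inj₂ i) (inj₁ j) = <ᵇ-false (ℕₚ.≤-trans (ℕₚ.<⇒≤ (toℕ<n j)) (ℕₚ.m≤m+n _ _))
pos-before {k} {l} p (inj₂ i) (inj₂ j) = <ᵇ-cong
  (λ lt → ∸-suc-reflects-< (toℕ<n j) (ℕₚ.+-cancelˡ-< k _ _ lt))
  (λ j<i → ℕₚ.+-monoʳ-< k (ℕₚ.∸-monoʳ-< (s≤s j<i) (toℕ<n i)))

pos-injective : ∀ {k l} (p : Part k l) {α β} → pos p α ≡ pos p β → α ≡ β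
pos-injective p {inj₁ i} {inj₁ j} eq = cong inj₁ (toℕ-injective eq)
pos-injective {k} p {inj₁ i} {inj₂ j} eq =
  contradiction (subst (_< k) eq (toℕ<n i)) (ℕₚ.m+n≮m k _)
pos-injective {k} p {inj₂ i} {inj₁ j} eq =
  contradiction (subst (_< k) (sym eq) (toℕ<n j)) (ℕₚ.m+n≮m k _)
pos-injective {k} {l} p {inj₂ i} {inj₂ j} eq = cong inj₂ (toℕ-injective (ℕₚ.suc-injective
  (ℕₚ.∸-cancelˡ-≡ (toℕ<n i) (toℕ<n j) (ℕₚ.+-cancelˡ-≡ k _ _ eq))))

-- The walk around the circle and the color distance

lower : ∀ {k l} → Part k l → Fin k → Color
lower p i = col p (inj₁ i)

upper : ∀ {k l} → Part k l → Fin l → Color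
upper p j = col p (inj₂ j)

-- The upper row is read from left to right with its own colours. The circle traverses the same
-- steps backwards with inverted sign, so their lower ends agree up to the constant `Σp p`. Since
-- heights depend on the row alone, exchanging rows or identifying two equally coloured rows
-- respects them.
ht : ∀ {k l} → Part k l → Pt k l → ℤ
ht p (inj₁ i) = height (lower p) i
ht p (inj₂ j) = height (upper p) j

wt-weight : ∀ {k l} (p : Part k l) α → wt p α ≡ weight (ncol p α)
wt-weight p α with ncol p α
... | white = refl
... | black = refl

module _ {k l : ℕ} (p : Part k l) where

  foldr-allPts : (f : Pt k l → ℤ) → foldr (λ γ acc → f γ ℤ.+ acc) 0ℤ (allPts k l) ≡
                 sumFin (f ∘ inj₁) ℤ.+ sumFin (f ∘ inj₂)
  foldr-allPts f =
    trans (cong₂ (λ xs ys → fold (xs ++ ys)) (map-tabulate {n = k} id inj₁) (map-tabulate {n = l} id inj₂))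
    (trans (foldr-tabulate-++ {k} inj₁ (tabulate inj₂))
    (cong (ℤ._+_ (sumFin (f ∘ inj₁))) (foldr-tabulate {l} inj₂)))
    where
    fold : List (Pt k l) → ℤ
    fold = foldr (λ γ acc → f γ ℤ.+ acc) 0ℤ
    foldr-tabulate-++ : ∀ {n} (h : Fin n → Pt k l) ys →
      fold (tabulate h ++ ys) ≡ sumFin (f ∘ h) ℤ.+ fold ys
    foldr-tabulate-++ {zero}  h ys = sym (ℤₚ.+-identityˡ _)
    foldr-tabulate-++ {suc n} h ys = trans (cong (ℤ._+_ (f (h zero))) (foldr-tabulate-++ (h ∘ suc) ys))
      (sym (ℤₚ.+-assoc (f (h zero)) _ _))
    foldr-tabulate : ∀ {n} (h : Fin n → Pt k l) →
      fold (tabulate h) ≡ sumFin (f ∘ h)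
    foldr-tabulate {zero}  h = refl
    foldr-tabulate {suc n} h = cong (ℤ._+_ (f (h zero))) (foldr-tabulate (h ∘ suc))

  restrict : (Pt k l → Bool) → Pt k l → ℤ
  restrict S γ = if S γ then wt p γ else 0ℤ

  -- The normalized colour of an upper point is inverted, hence the minus sign.
  σ-rows : (S : Pt k l → Bool) → σ p S ≡
           sumFin (λ i → if S (inj₁ i) then weight (lower p i) else 0ℤ) ℤ.-
           sumFin (λ j → if S (inj₂ j) then weight (upper p j) else 0ℤ)
  σ-rows S = trans (foldr-allPts (restrict S)) (cong₂ ℤ._+_ (sumFin-cong lo) up)
    where
    lo : ∀ i → restrict S (inj₁ i) ≡ (if S (inj₁ i) then weight (lower p i) else 0ℤ)
    lo i = cong (λ w → if S (inj₁ i) then w else 0ℤ) (wt-weight p (inj₁ i))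
    neg : ∀ j → restrict S (inj₂ j) ≡ 0ℤ ℤ.- (if S (inj₂ j) then weight (upper p j) else 0ℤ)
    neg j with S (inj₂ j)
    ... | false = refl
    ... | true  = trans (wt-weight p (inj₂ j))
                    (trans (weight-inv (upper p j)) (sym (ℤₚ.+-identityˡ _)))
    raw : Fin l → ℤ
    raw j = if S (inj₂ j) then weight (upper p j) else 0ℤ
    up : sumFin (restrict S ∘ inj₂) ≡ - sumFin raw
    up = trans (sumFin-cong neg) (trans (sumFin-- (λ _ → 0ℤ) raw)
           (trans (cong (ℤ._- sumFin raw) (sumFin-0 {l} {λ _ → 0ℤ} (λ _ → refl))) (ℤₚ.+-identityˡ _)))

  Σp-rows : Σp p ≡ total (lower p) ℤ.- total (upper p)
  Σp-rows = trans (σ-rows (λ _ → true))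
    (sym (cong₂ ℤ._-_ (total-sum (lower p)) (total-sum (upper p))))

  level : ℕ → ℤ
  level t = σ p (λ γ → pos p γ <ᵇ t)

  level-lower : ∀ {t} → t ≤ k → level t ≡ prefix (lower p) t
  level-lower {t} t≤k = trans (σ-rows (λ γ → pos p γ <ᵇ t)) (trans (cong (λ z → prefix (lower p) t ℤ.- z) none)
                                                (ℤₚ.+-identityʳ _))
    where
    none : sumFin (λ j → if pos p (inj₂ j) <ᵇ t then weight (upper p j) else 0ℤ) ≡ 0ℤ
    none = sumFin-0 (λ j → cong (λ b → if b then weight (upper p j) else 0ℤ)
             (<ᵇ-false (ℕₚ.≤-trans t≤k (ℕₚ.m≤m+n k _))))

  -- Once the lower row is passed, the upper points already met are those of rank at least `s`. They
  -- subtract `total (upper p)` less the prefix, and the two totals combine to `Σp p`.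
  level-upper : ∀ t s → (∀ j → (pos p (inj₂ j) <ᵇ k + t) ≡ not (toℕ j <ᵇ s)) →
                level (k + t) ≡ Σp p ℤ.+ prefix (upper p) s
  level-upper t s split = begin
    level (k + t)
      ≡⟨ σ-rows (λ γ → pos p γ <ᵇ k + t) ⟩
    sumFin (λ i → if toℕ i <ᵇ k + t then weight (lower p i) else 0ℤ) ℤ.-
    sumFin (λ j → if pos p (inj₂ j) <ᵇ k + t then weight (upper p j) else 0ℤ)
      ≡⟨ cong₂ ℤ._-_ lo up ⟩
    total (lower p) ℤ.- (total (upper p) ℤ.- prefix (upper p) s)
      ≡⟨ regroup (total (lower p)) (total (upper p)) (prefix (upper p) s) ⟩
    (total (lower p) ℤ.- total (upper p)) ℤ.+ prefix (upper p) s
      ≡⟨ cong (ℤ._+ prefix (upper p) s) (sym Σp-rows) ⟩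
    Σp p ℤ.+ prefix (upper p) s ∎
    where
    open ≡-Reasoning
    regroup : ∀ a b c → a ℤ.- (b ℤ.- c) ≡ (a ℤ.- b) ℤ.+ c
    regroup = solve-∀
    lo : sumFin (λ i → if toℕ i <ᵇ k + t then weight (lower p i) else 0ℤ) ≡ total (lower p)
    lo = sumFin-cong (λ i → cong (λ b → if b then weight (lower p i) else 0ℤ)
      (trans (<ᵇ-true (ℕₚ.≤-trans (toℕ<n i) (ℕₚ.m≤m+n k t))) (sym (<ᵇ-true (toℕ<n i)))))
    pick : ∀ b w → (if not b then w else 0ℤ) ≡ w ℤ.- (if b then w else 0ℤ)
    pick true  w = sym (ℤₚ.+-inverseʳ w)
    pick false w = sym (ℤₚ.+-identityʳ w)
    up : sumFin (λ j → if pos p (inj₂ j) <ᵇ k + t then weight (upper p j) else 0ℤ) ≡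
         total (upper p) ℤ.- prefix (upper p) s
    up = trans (sumFin-cong (λ j → trans (cong (λ b → if b then weight (upper p j) else 0ℤ) (split j))
                                         (pick (toℕ j <ᵇ s) (weight (upper p j)))))
           (trans (sumFin-- (weight ∘ upper p) (λ j → if toℕ j <ᵇ s then weight (upper p j) else 0ℤ))
             (cong (ℤ._- prefix (upper p) s) (sym (total-sum (upper p)))))

  -- The left end of the upper row is at 0 for `ht`, but it is where the walk around the circle
  -- ends, hence at `Σp p`.
  base : Pt k l → ℤ
  base (inj₁ _) = 0ℤ
  base (inj₂ _) = Σp p

  level-upper-pos : ∀ j → level (pos p (inj₂ j)) ≡ Σp p ℤ.+ prefix (upper p) (suc (toℕ j))
  level-upper-pos j = level-upper _ (suc (toℕ j)) λ i →
    trans (pos-before p (inj₂ i) (inj₂ j)) (does-⇔ (mk⇔ (λ j<i → ℕₚ.≤⇒≯ j<i) ℕₚ.≮⇒≥)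
      (toℕ j <? toℕ i) (¬? (toℕ i <? suc (toℕ j))))

  level-upper-suc : ∀ j → level (suc (pos p (inj₂ j))) ≡ Σp p ℤ.+ prefix (upper p) (toℕ j)
  level-upper-suc j = trans (cong level (sym (ℕₚ.+-suc k _)))
    (level-upper _ (toℕ j) λ i → trans (cong (pos p (inj₂ i) <ᵇ_) (ℕₚ.+-suc k _))
      (trans (<ᵇ-suc (pos p (inj₂ i)) (pos p (inj₂ j))) (cong not (pos-before p (inj₂ j) (inj₂ i)))))
    where
    <ᵇ-suc : ∀ m n → (m <ᵇ suc n) ≡ not (n <ᵇ m)
    <ᵇ-suc m n = does-⇔ (mk⇔ (λ m≤n → ℕₚ.≤⇒≯ (ℕ.s≤s⁻¹ m≤n)) (λ ≮ → s≤s (ℕₚ.≮⇒≥ ≮)))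
      (m <? suc n) (¬? (n <? m))

  level-bottom : ∀ α → level (lift (ncol p α) (pos p α)) ≡ ht p α ℤ.+ base α
  level-bottom (inj₁ i) = trans (level-lower (lift-≤ (lower p i) (toℕ<n i))) (sym (ℤₚ.+-identityʳ _))
  level-bottom (inj₂ j) with upper p j
  ... | white = trans (level-upper-suc j) (ℤₚ.+-comm (Σp p) _)
  ... | black = trans (level-upper-pos j) (ℤₚ.+-comm (Σp p) _)

  level-top : ∀ α → level (lift (inv (ncol p α)) (pos p α)) ≡ (ht p α ℤ.+ base α) ℤ.+ 1ℤ
  level-top (inj₁ i) = trans (level-lower (lift-≤ (inv (lower p i)) (toℕ<n i)))
    (trans (height-top (lower p) i) (cong (ℤ._+ 1ℤ) (sym (ℤₚ.+-identityʳ (height (lower p) i)))))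
  level-top (inj₂ j) = trans (top (upper p j))
    (trans (cong (ℤ._+_ (Σp p)) (height-top (upper p) j)) (regroup (Σp p) (height (upper p) j)))
    where
    regroup : ∀ a b → a ℤ.+ (b ℤ.+ 1ℤ) ≡ (b ℤ.+ a) ℤ.+ 1ℤ
    regroup = solve-∀
    top : ∀ x → level (lift (inv (inv x)) (pos p (inj₂ j))) ≡ Σp p ℤ.+ prefix (upper p) (lift (inv x) (toℕ j))
    top white = level-upper-pos j
    top black = level-upper-suc j

  σ-combine : (S S₁ S₂ S₃ : Pt k l → Bool) →
    (∀ γ w → (if S γ then w else 0ℤ) ≡
       ((if S₁ γ then w else 0ℤ) ℤ.- (if S₂ γ then w else 0ℤ)) ℤ.+ (if S₃ γ then w else 0ℤ)) →
    σ p S ≡ (σ p S₁ ℤ.- σ p S₂) ℤ.+ σ p S₃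
  σ-combine S S₁ S₂ S₃ split = go (allPts k l)
    where
    fold : (Pt k l → Bool) → List (Pt k l) → ℤ
    fold T = foldr (λ γ acc → restrict T γ ℤ.+ acc) 0ℤ
    regroup : ∀ a b c a′ b′ c′ → ((a ℤ.- b) ℤ.+ c) ℤ.+ ((a′ ℤ.- b′) ℤ.+ c′) ≡
              ((a ℤ.+ a′) ℤ.- (b ℤ.+ b′)) ℤ.+ (c ℤ.+ c′)
    regroup = solve-∀
    go : ∀ xs → fold S xs ≡ (fold S₁ xs ℤ.- fold S₂ xs) ℤ.+ fold S₃ xs
    go []       = refl
    go (γ ∷ xs) = trans (cong₂ ℤ._+_ (split γ (wt p γ)) (go xs))
      (regroup (restrict S₁ γ) (restrict S₂ γ) (restrict S₃ γ) _ _ _)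

  -- What an interval from α to β picks up when it runs past the start of the lower row.
  wrap : Pt k l → Pt k l → ℤ
  wrap α β = σ p (λ _ → not (pos p α <ᵇ pos p β))

  -- On indicators: the points before β, minus those up to and including α, plus every point once if
  -- the interval runs past the start.
  σ-inOpen : ∀ α β → σ p (inOpen p α β) ≡
             (level (pos p β) ℤ.- level (suc (pos p α))) ℤ.+ wrap α β
  σ-inOpen α β = σ-combine (inOpen p α β) (λ γ → pos p γ <ᵇ b) (λ γ → pos p γ <ᵇ suc a) (λ _ → not (a <ᵇ b)) split
    where
    a = pos p α
    b = pos p β
    split : ∀ γ w → (if inOpen p α β γ then w else 0ℤ) ≡
      ((if pos p γ <ᵇ b then w else 0ℤ) ℤ.- (if pos p γ <ᵇ suc a then w else 0ℤ)) ℤ.+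
      (if not (a <ᵇ b) then w else 0ℤ)
    split γ w with a <? b | pos p γ <? suc a
    ... | yes a<b | yes c≤a
      rewrite <ᵇ-true a<b | <ᵇ-true c≤a | <ᵇ-false (ℕ.s≤s⁻¹ c≤a) | <ᵇ-true (ℕₚ.≤-<-trans (ℕ.s≤s⁻¹ c≤a) a<b)
      = cancel w
      where
      cancel : ∀ w → 0ℤ ≡ (w ℤ.- w) ℤ.+ 0ℤ
      cancel = solve-∀
    ... | yes a<b | no c≰a
      rewrite <ᵇ-true a<b | <ᵇ-false (ℕₚ.≮⇒≥ c≰a) | <ᵇ-true (ℕₚ.≮⇒≥ c≰a)
      = pad _
      where
      pad : ∀ w → w ≡ (w ℤ.- 0ℤ) ℤ.+ 0ℤ
      pad = solve-∀
    ... | no a≮b | yes c≤a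
      rewrite <ᵇ-false (ℕₚ.≮⇒≥ a≮b) | <ᵇ-true c≤a | <ᵇ-false (ℕ.s≤s⁻¹ c≤a)
      = pad _ w
      where
      pad : ∀ v w → v ≡ (v ℤ.- w) ℤ.+ w
      pad = solve-∀
    ... | no a≮b | no c≰a
      rewrite <ᵇ-false (ℕₚ.≮⇒≥ a≮b) | <ᵇ-false (ℕₚ.≮⇒≥ c≰a) | <ᵇ-true (ℕₚ.≮⇒≥ c≰a)
            | <ᵇ-false (ℕₚ.≤-trans (ℕₚ.≮⇒≥ a≮b) (ℕₚ.<⇒≤ (ℕₚ.≮⇒≥ c≰a)))
      = pad w
      where
      pad : ∀ w → w ≡ 0ℤ ℤ.+ w
      pad = solve-∀

module _ {k l : ℕ} (p : Part k l) where

  pos-≢ : ∀ {α β} → α ≢ β → pos p α ≢ pos p β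
  pos-≢ α≢β = α≢β ∘ pos-injective p

  σ-inHalf : ∀ {α β} → α ≢ β → σ p (inHalf p α β) ≡
             (level p (suc (pos p β)) ℤ.- level p (suc (pos p α))) ℤ.+ wrap p α β
  σ-inHalf {α} {β} α≢β = σ-combine p (inHalf p α β)
    (λ γ → pos p γ <ᵇ suc b) (λ γ → pos p γ <ᵇ suc a) (λ _ → not (a <ᵇ b)) split
    where
    a = pos p α
    b = pos p β
    split : ∀ γ w → (if inHalf p α β γ then w else 0ℤ) ≡
      ((if pos p γ <ᵇ suc b then w else 0ℤ) ℤ.- (if pos p γ <ᵇ suc a then w else 0ℤ)) ℤ.+
      (if not (a <ᵇ b) then w else 0ℤ)
    split γ w with <-cmp a b | pos p γ <? suc a
    ... | tri≈ _ a≡b _ | _ = contradiction a≡b (pos-≢ α≢β)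
    ... | tri< a<b _ _ | yes c≤a
      rewrite <ᵇ-true a<b | <ᵇ-true c≤a | <ᵇ-false (ℕ.s≤s⁻¹ c≤a)
            | <ᵇ-true (ℕₚ.<-trans c≤a (s≤s a<b))
            | ≡ᵇ-false (ℕₚ.<⇒≢ (ℕₚ.≤-<-trans (ℕ.s≤s⁻¹ c≤a) a<b))
      = cancel w
      where
      cancel : ∀ w → 0ℤ ≡ (w ℤ.- w) ℤ.+ 0ℤ
      cancel = solve-∀
    ... | tri< a<b _ _ | no c≰a
      rewrite <ᵇ-true a<b | <ᵇ-false (ℕₚ.≮⇒≥ c≰a) | <ᵇ-true (ℕₚ.≮⇒≥ c≰a) | <ᵇ-∨-≡ᵇ (pos p γ) b
      = pad _
      where
      pad : ∀ w → w ≡ (w ℤ.- 0ℤ) ℤ.+ 0ℤ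
      pad = solve-∀
    ... | tri> _ _ b<a | yes c≤a
      rewrite <ᵇ-false (ℕₚ.<⇒≤ b<a) | <ᵇ-true c≤a | <ᵇ-false (ℕ.s≤s⁻¹ c≤a) | <ᵇ-∨-≡ᵇ (pos p γ) b
      = pad _ w
      where
      pad : ∀ v w → v ≡ (v ℤ.- w) ℤ.+ w
      pad = solve-∀
    ... | tri> _ _ b<a | no c≰a
      rewrite <ᵇ-false (ℕₚ.<⇒≤ b<a) | <ᵇ-false (ℕₚ.≮⇒≥ c≰a) | <ᵇ-true (ℕₚ.≮⇒≥ c≰a)
            | <ᵇ-false (ℕₚ.≤-trans (s≤s (ℕₚ.<⇒≤ b<a)) (ℕₚ.≮⇒≥ c≰a))
      = pad w
      where
      pad : ∀ w → w ≡ 0ℤ ℤ.+ w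
      pad = solve-∀

  -- A multiple of `Σp p`, by which the color distance deviates from the difference of heights.
  offset : Pt k l → Pt k l → ℤ
  offset α β = (base p β ℤ.- base p α) ℤ.+ wrap p α β

  private
    regroup : ∀ a a′ b b′ w → ((b ℤ.+ b′) ℤ.- (a ℤ.+ a′)) ℤ.+ w ≡ (b ℤ.- a) ℤ.+ ((b′ ℤ.- a′) ℤ.+ w)
    regroup = solve-∀

    regroup-top : ∀ a a′ b b′ w → (((b ℤ.+ b′) ℤ.+ 1ℤ) ℤ.- ((a ℤ.+ a′) ℤ.+ 1ℤ)) ℤ.+ w ≡
                  (b ℤ.- a) ℤ.+ ((b′ ℤ.- a′) ℤ.+ w)
    regroup-top = solve-∀

  -- A white step ends at its upper end, a black step starts there. Taking the half-open interval
  -- for equal normalized colours and the open one for different colours means that the two values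
  -- of the walk being subtracted are both upper ends or both lower ends, so their difference is the
  -- difference of heights.
  δ-ht : ∀ {α β} → α ≢ β → δ p α β ≡ (ht p β ℤ.- ht p α) ℤ.+ offset α β
  δ-ht {α} {β} α≢β rewrite ≡ᵇ-false (pos-≢ α≢β)
    with ncol p α | ncol p β | level-bottom p α | level-top p α | level-bottom p β | level-top p β
  ... | white | white | _ | topα | _ | topβ rewrite σ-inHalf α≢β | topα | topβ =
    regroup-top (ht p α) (base p α) (ht p β) (base p β) (wrap p α β)
  ... | white | black | _ | topα | _ | topβ rewrite σ-inOpen p α β | topα | topβ =
    regroup-top (ht p α) (base p α) (ht p β) (base p β) (wrap p α β)
  ... | black | white | botα | _ | botβ | _ rewrite σ-inOpen p α β | botα | botβ =
    regroup (ht p α) (base p α) (ht p β) (base p β) (wrap p α β)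
  ... | black | black | botα | _ | botβ | _ rewrite σ-inHalf α≢β | botα | botβ =
    regroup (ht p α) (base p α) (ht p β) (base p β) (wrap p α β)

  σ-∅ : σ p (λ _ → false) ≡ 0ℤ
  σ-∅ = trans (foldr-allPts p (λ _ → 0ℤ))
    (cong₂ ℤ._+_ (sumFin-0 {k} {λ _ → 0ℤ} (λ _ → refl)) (sumFin-0 {l} {λ _ → 0ℤ} (λ _ → refl)))

  wrap-multiple : ∀ α β → wrap p α β ≡ 0ℤ ⊎ wrap p α β ≡ Σp p
  wrap-multiple α β with pos p α <ᵇ pos p β
  ... | true  = inj₁ σ-∅
  ... | false = inj₂ refl

  -- If α precedes β, then γ lies in between exactly when one of the two comparisons with γ holds;
  -- if β precedes α, the answer is the complement, which the last term records. In this additive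
  -- form the orientation term cancels when two memberships are combined.
  inOpen-xor : ∀ {α β γ} → α ≢ γ → β ≢ γ → α ≢ β →
               inOpen p α β γ ≡ (before α γ xor before β γ) xor not (before α β)
  inOpen-xor {α} {β} {γ} α≢γ β≢γ α≢β
    rewrite sym (pos-before p α γ) | sym (pos-before p β γ) | sym (pos-before p α β)
          | <ᵇ-swap (pos-≢ β≢γ ∘ sym)
    = bits (pos p α) (pos p β) (pos p γ) (pos-≢ α≢γ) (pos-≢ β≢γ) (pos-≢ α≢β)
    where
    bits : ∀ a b c → a ≢ c → b ≢ c → a ≢ b →
      (if a <ᵇ b then (a <ᵇ c) ∧ not (b <ᵇ c) else ((a <ᵇ c) ∨ not (b <ᵇ c))) ≡
      ((a <ᵇ c) xor (b <ᵇ c)) xor not (a <ᵇ b)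
    bits a b c a≢c b≢c a≢b with <-cmp a b
    ... | tri≈ _ a≡b _ = contradiction a≡b a≢b
    ... | tri< a<b _ _ rewrite <ᵇ-true a<b with a <? c
    ...   | yes a<c rewrite <ᵇ-true a<c with b <ᵇ c
    ...     | true  = refl
    ...     | false = refl
    bits a b c _ _ _ | tri< a<b _ _ | no a≮c
      rewrite <ᵇ-false (ℕₚ.≮⇒≥ a≮c) | <ᵇ-false (ℕₚ.≤-trans (ℕₚ.≮⇒≥ a≮c) (ℕₚ.<⇒≤ a<b)) = refl
    bits a b c _ _ _ | tri> _ _ b<a rewrite <ᵇ-false (ℕₚ.<⇒≤ b<a) with a <? c
    ...   | yes a<c rewrite <ᵇ-true a<c | <ᵇ-true (ℕₚ.<-trans b<a a<c) = refl
    ...   | no a≮c rewrite <ᵇ-false (ℕₚ.≮⇒≥ a≮c) with b <ᵇ c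
    ...     | true  = refl
    ...     | false = refl

  inOpen-distinct : ∀ {α β γ} → α ≢ β → inOpen p α β γ ≡ true → γ ≢ α × γ ≢ β
  inOpen-distinct {α} {β} {γ} α≢β in-αβ = left , right
    where
    left : γ ≢ α
    left refl with <-cmp (pos p α) (pos p β)
    ... | tri≈ _ a≡b _ = pos-≢ α≢β a≡b
    ... | tri< a<b _ _ rewrite <ᵇ-true a<b | <ᵇ-false (ℕₚ.≤-refl {pos p α}) = contradiction in-αβ λ ()
    ... | tri> _ _ b<a rewrite <ᵇ-false (ℕₚ.<⇒≤ b<a) | <ᵇ-false (ℕₚ.≤-refl {pos p α}) = contradiction in-αβ λ ()
    right : γ ≢ β
    right refl with <-cmp (pos p α) (pos p β)
    ... | tri≈ _ a≡b _ = pos-≢ α≢β a≡b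
    ... | tri< a<b _ _ rewrite <ᵇ-true a<b | <ᵇ-false (ℕₚ.≤-refl {pos p β}) = contradiction in-αβ λ ()
    ... | tri> _ _ b<a rewrite <ᵇ-false (ℕₚ.<⇒≤ b<a) | <ᵇ-false (ℕₚ.≤-refl {pos p β}) = contradiction in-αβ λ ()

before-swap : ∀ {k l} {α β : Pt k l} → α ≢ β → before α β ≡ not (before β α)
before-swap {α = inj₁ i} {inj₁ j} α≢β = <ᵇ-swap (α≢β ∘ cong inj₁ ∘ toℕ-injective)
before-swap {α = inj₁ i} {inj₂ j} α≢β = refl
before-swap {α = inj₂ i} {inj₁ j} α≢β = refl
before-swap {α = inj₂ i} {inj₂ j} α≢β = <ᵇ-swap (α≢β ∘ cong inj₂ ∘ sym ∘ toℕ-injective)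

-- Diagrams and the erasing of turns

-- A partition up to what the constraints see: blocks, the linear order of the
-- points around the circle, normalized colours and heights.
record Diagram (V : Set) : Set where
  field
    lab : V → ℕ
    lt  : V → V → Bool
    clr : V → Color
    alt : V → ℤ

diagram : ∀ {k l} → Part k l → Diagram (Pt k l)
diagram p = record { lab = blk p ; lt = before ; clr = ncol p ; alt = ht p }

-- Whether the chords ab and xy cross.
links : ∀ {V : Set} → (V → V → Bool) → V → V → V → V → Bool
links lt a b x y = (lt a x xor lt b x) xor (lt a y xor lt b y)

-- The conditions `{2}`, `{1,2}` and ℕ on block sizes. `Bounded` and `Paired` guard the statements
-- about points of a block that survive in each case.
data Size : Set where
  exactlyTwo atMostTwo arbitrary : Size

Bounded : Size → Set
Bounded arbitrary = ⊥
Bounded _         = ⊤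

Paired : Size → Set
Paired exactlyTwo = ⊤
Paired _          = ⊥

paired⇒bounded : ∀ κ → Paired κ → Bounded κ
paired⇒bounded exactlyTwo _ = tt

module _ (Q : Tuple) where
  open Tuple Q

  -- Equal normalized colours are the case in which σ of the pair is nonzero, governed by `l`;
  -- different colours are governed by `k`.
  PairOK : Color → Color → ℤ → Set
  PairOK white white = lS
  PairOK white black = kS
  PairOK black white = kS
  PairOK black black = lS

  -- `s` enters through the multiples of `Σp p` that separate color distances from height
  -- differences. `l+l` lands in `k` because colours flip at a turn. `x+k` and `x+l` move one end of
  -- a crossing along its block.
  record Laws : Set where
    field
      s-0   : sS 0ℤ
      s-+   : ∀ {a b} → sS a → sS b → sS (a ℤ.+ b)
      s-neg : ∀ {a} → sS a → sS (- a)
      s⇒k   : ∀ {a} → sS a → kS a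
      k+k   : ∀ {a b} → kS a → kS b → kS (a ℤ.+ b)
      k-neg : ∀ {a} → kS a → kS (- a)
      l+k   : ∀ {a b} → lS a → kS b → lS (a ℤ.+ b)
      l+l   : ∀ {a b} → lS a → lS b → kS (a ℤ.+ b)
      x+k   : ∀ {a b} → xS a → kS b → xS (a ℤ.+ b)
      x+l   : ∀ {a b} → xS a → lS b → xS (a ℤ.+ b)

  module Theory (laws : Laws) (κ : Size) where
    open Laws laws

    k+l : ∀ {a b} → kS a → lS b → lS (a ℤ.+ b)
    k+l {a} {b} ka lb = subst lS (ℤₚ.+-comm b a) (l+k lb ka)

    -- The path passes a turn in the middle: it arrives at colour `c′` and departs from the opposite
    -- colour.
    PairOK-trans : ∀ c c′ c″ {a b} → PairOK c c′ a → PairOK (inv c′) c″ b → PairOK c c″ (a ℤ.+ b)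
    PairOK-trans white white white = l+k
    PairOK-trans white white black = l+l
    PairOK-trans white black white = k+l
    PairOK-trans white black black = k+k
    PairOK-trans black white white = k+k
    PairOK-trans black white black = k+l
    PairOK-trans black black white = l+l
    PairOK-trans black black black = l+k

    PairOK-shift : ∀ c c′ {a s} → PairOK c c′ a → sS s → PairOK c c′ (a ℤ.+ s)
    PairOK-shift white white la s = l+k la (s⇒k s)
    PairOK-shift white black ka s = k+k ka (s⇒k s)
    PairOK-shift black white ka s = k+k ka (s⇒k s)
    PairOK-shift black black la s = l+k la (s⇒k s)

    PairOK-inv : ∀ c c′ {a} → PairOK c c′ a → PairOK (inv c) (inv c′) a
    PairOK-inv white white = id
    PairOK-inv white black = id
    PairOK-inv black white = id
    PairOK-inv black black = id

    x-PairOK : ∀ c c′ {a b} → xS a → PairOK c c′ b → xS (a ℤ.+ b)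
    x-PairOK white white = x+l
    x-PairOK white black = x+k
    x-PairOK black white = x+k
    x-PairOK black black = x+l

    x-shift : ∀ {a s} → xS a → sS s → xS (a ℤ.+ s)
    x-shift xa s = x+k xa (s⇒k s)

    -- Only the points satisfying A are regarded as points of the diagram.
    record Admissible {V : Set} (A : V → Set) (d : Diagram V) : Set where
      open Diagram d
      field
        bounded : Bounded κ → ∀ {x y z} → A x → A y → A z →
                  lab x ≡ lab y → lab x ≡ lab z → x ≡ y ⊎ x ≡ z ⊎ y ≡ z
        partner : Paired κ → ∀ {x} → A x → ∃[ y ] (A y × y ≢ x × lab y ≡ lab x)
        pairs   : ∀ {x y} → A x → A y → x ≢ y → lab x ≡ lab y →
                  PairOK (clr x) (clr y) (alt y ℤ.- alt x)
        crossed : ∀ {a b x y} → A a → A b → A x → A y →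
                  lab a ≡ lab b → lab x ≡ lab y → lab a ≢ lab x →
                  links lt a b x y ≡ true → xS (alt x ℤ.- alt a)

    -- `flat` holds because the walk takes a step and at once takes it back. The order conditions
    -- say that no surviving point separates `f` from `g`.
    record Turn {V : Set} (A A′ : V → Set) (d : Diagram V) (f g : V) : Set where
      open Diagram d
      field
        f∈    : A f
        g∈    : A g
        f≢g   : f ≢ g
        color : clr g ≡ inv (clr f)
        flat : alt g ≡ alt f
        lt-f  : ∀ {y} → A′ y → lt f y ≡ lt g y
        f-lt  : ∀ {y} → A′ y → lt y f ≡ lt y g

    Turn-sym : ∀ {V : Set} {A A′ : V → Set} {d : Diagram V} {f g} → Turn A A′ d f g → Turn A A′ d g f
    Turn-sym {d = d} {f} t = record
      { f∈ = g∈ ; g∈ = f∈ ; f≢g = f≢g ∘ sym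
      ; color = trans (sym (inv-inv (Diagram.clr d f))) (cong inv (sym color))
      ; flat = sym flat
      ; lt-f = sym ∘ lt-f ; f-lt = sym ∘ f-lt
      }
      where open Turn t

    merge : ℕ → ℕ → ℕ → ℕ
    merge a b n with n ≟ b
    ... | yes _ = a
    ... | no _  = n

    merge-≡ : ∀ a b → merge a b a ≡ merge a b b
    merge-≡ a b with a ≟ b | b ≟ b
    ... | yes _ | yes _ = refl
    ... | no _  | yes _ = refl
    ... | _     | no b≢b = contradiction refl b≢b

    merge-reflects : ∀ a b {m n} → merge a b m ≡ merge a b n →
                     m ≡ n ⊎ (m ≡ a × n ≡ b) ⊎ (m ≡ b × n ≡ a)
    merge-reflects a b {m} {n} eq with m ≟ b | n ≟ b
    ... | yes m≡b | yes n≡b = inj₁ (trans m≡b (sym n≡b))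
    ... | yes m≡b | no _    = inj₂ (inj₂ (m≡b , sym eq))
    ... | no _    | yes n≡b = inj₂ (inj₁ (eq , n≡b))
    ... | no _    | no _    = inj₁ eq

    -- Modulo 2, the values for the chords `a f` and `f b` add up to the value for `a b`, since the
    -- terms in `f` occur twice. As `g` compares like `f`, the second chord may start at `g`. A sum
    -- equal to 1 has a summand equal to 1.
    links-split : ∀ {V : Set} (lt : V → V → Bool) {a b x y} f g → lt f x ≡ lt g x → lt f y ≡ lt g y →
                  links lt a b x y ≡ true → links lt a f x y ≡ true ⊎ links lt g b x y ≡ true
    links-split lt {a} {b} {x} {y} f g fx fy eq
      with links lt a f x y in eq₁
    ... | true = inj₁ refl
    ... | false = inj₂ (trans
      (trans (cong₂ (λ u v → (u xor lt b x) xor (v xor lt b y)) (sym fx) (sym fy))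
             (split (lt a x) (lt b x) (lt a y) (lt b y) (lt f x) (lt f y)))
      (cong₂ _xor_ eq₁ eq))
      where
      open xor-∧-Solver
      split : ∀ p q r s u v → (u xor q) xor (v xor s) ≡
              ((p xor u) xor (r xor v)) xor ((p xor q) xor (r xor s))
      split = solve 6 (λ p q r s u v → (u :+ q) :+ (v :+ s) :=
              ((p :+ u) :+ (r :+ v)) :+ ((p :+ q) :+ (r :+ s))) refl

    links-splitʳ : ∀ {V : Set} (lt : V → V → Bool) {a b x y} f g → lt a f ≡ lt a g → lt b f ≡ lt b g →
                   links lt a b x y ≡ true → links lt a b x f ≡ true ⊎ links lt a b g y ≡ true
    links-splitʳ lt {a} {b} {x} {y} f g af bf eq
      with links lt a b x f in eq₁
    ... | true = inj₁ refl
    ... | false = inj₂ (trans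
      (trans (cong₂ (λ u v → (u xor v) xor (lt a y xor lt b y)) (sym af) (sym bf))
             (split (lt a x) (lt b x) (lt a y) (lt b y) (lt a f) (lt b f)))
      (cong₂ _xor_ eq₁ eq))
      where
      open xor-∧-Solver
      split : ∀ p q r s u v → (u xor v) xor (r xor s) ≡
              ((p xor q) xor (u xor v)) xor ((p xor q) xor (r xor s))
      split = solve 6 (λ p q r s u v → (u :+ v) :+ (r :+ s) :=
              ((p :+ q) :+ (u :+ v)) :+ ((p :+ q) :+ (r :+ s))) refl

    module Erase {V : Set} (A A′ : V → Set) (d : Diagram V) (adm : Admissible A d) (f g : V)
      (turn : Turn A A′ d f g)
      (kept : ∀ {v} → A′ v → A v × v ≢ f × v ≢ g)
      (keep : ∀ {v} → A v → v ≢ f → v ≢ g → A′ v) where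
      open Diagram d
      open Admissible adm

      lab′ : V → ℕ
      lab′ = merge (lab f) (lab g) ∘ lab

      lab′-cong : ∀ {x y} → lab x ≡ lab y → lab′ x ≡ lab′ y
      lab′-cong = cong (merge (lab f) (lab g))

      erased : Diagram V
      erased = record { lab = lab′ ; lt = lt ; clr = clr ; alt = alt }

      glued : lab′ f ≡ lab′ g
      glued = merge-≡ (lab f) (lab g)

      -- `via` quantifies over the turn, so that passing it from `f` to `g` and from `g` to `f` fall
      -- under one case.
      data Joined (x y : V) : Set where
        same : lab x ≡ lab y → Joined x y
        via  : ∀ {f g} → Turn A A′ d f g → lab′ f ≡ lab′ g → x ≢ f → y ≢ g →
               lab x ≡ lab f → lab y ≡ lab g → Joined x y

      joined : ∀ {x y} → A′ x → A′ y → lab′ x ≡ lab′ y → Joined x y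
      joined x∈ y∈ eq with merge-reflects (lab f) (lab g) eq | kept x∈ | kept y∈
      ... | inj₁ same-lab | _ | _ = same same-lab
      ... | inj₂ (inj₁ (xf , yg)) | _ , x≢f , _ | _ , _ , y≢g = via turn glued x≢f y≢g xf yg
      ... | inj₂ (inj₂ (xg , yf)) | _ , _ , x≢g | _ , y≢f , _ =
        via (Turn-sym turn) (sym glued) x≢g y≢f xg yf

      -- The path leads from `x` to `f`, across the turn at constant height, and from `g` to `y`.
      pairOK-via : ∀ {f g x y} → Turn A A′ d f g → A x → A y → x ≢ f → y ≢ g →
                   lab x ≡ lab f → lab y ≡ lab g → PairOK (clr x) (clr y) (alt y ℤ.- alt x)
      pairOK-via {f} {g} {x} {y} t x∈ y∈ x≢f y≢g xf yg =
        subst (PairOK (clr x) (clr y))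
          (trans (cong (λ h → (alt f ℤ.- alt x) ℤ.+ (alt y ℤ.- h)) flat) (telescope (alt f) (alt x) (alt y)))
          (PairOK-trans (clr x) (clr f) (clr y) (pairs x∈ f∈ x≢f xf)
            (subst (λ c → PairOK c (clr y) _) color (pairs g∈ y∈ (y≢g ∘ sym) (sym yg))))
        where
        open Turn t
        telescope : ∀ f x y → (f ℤ.- x) ℤ.+ (y ℤ.- f) ≡ y ℤ.- x
        telescope = solve-∀

      -- The erased points lie on the same side of every chord between surviving points,
      -- so a chord through the turn links with it only if one of its two halves does.
      crossed-via : ∀ {f g a b x y} → Turn A A′ d f g → lab′ f ≡ lab′ g → A′ a → A′ b → A′ x → A′ y →
                    a ≢ f → lab a ≡ lab f → lab b ≡ lab g → lab x ≡ lab y → lab′ a ≢ lab′ x →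
                    links lt a b x y ≡ true → xS (alt x ℤ.- alt a)
      crossed-via {f} {g} {a} {b} {x} {y} t fg a∈ b∈ x∈ y∈ a≢f af bg xy a≢x lk
        with links-split lt f g (Turn.lt-f t x∈) (Turn.lt-f t y∈) lk
      ... | inj₁ lk₁ = crossed (proj₁ (kept a∈)) f∈ (proj₁ (kept x∈)) (proj₁ (kept y∈))
                         af xy (a≢x ∘ lab′-cong) lk₁
        where open Turn t
      ... | inj₂ lk₂ = subst xS
          (trans (cong (λ h → (alt x ℤ.- h) ℤ.+ (alt f ℤ.- alt a)) flat) (telescope (alt f) (alt a) (alt x)))
          (x-PairOK (clr a) (clr f)
            (crossed g∈ (proj₁ (kept b∈)) (proj₁ (kept x∈)) (proj₁ (kept y∈)) (sym bg) xy
              (λ gx → a≢x (trans (lab′-cong af) (trans fg (lab′-cong gx)))) lk₂)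
            (pairs (proj₁ (kept a∈)) f∈ a≢f af))
        where
        open Turn t
        telescope : ∀ f a x → (x ℤ.- f) ℤ.+ (f ℤ.- a) ≡ x ℤ.- a
        telescope = solve-∀

      -- `Laws` contains no closure of `xS` under negation, so the two ends of the difference
      -- `alt x - alt a` cannot be exchanged. A merged chord in second place needs its own argument.
      crossed-via′ : ∀ {f g a b x y} → Turn A A′ d f g → lab′ f ≡ lab′ g → A′ a → A′ b → A′ x → A′ y →
                     x ≢ f → lab x ≡ lab f → lab y ≡ lab g → lab a ≡ lab b → lab′ a ≢ lab′ x →
                     links lt a b x y ≡ true → xS (alt x ℤ.- alt a)
      crossed-via′ {f} {g} {a} {b} {x} {y} t fg a∈ b∈ x∈ y∈ x≢f xf yg ab a≢x lk
        with links-splitʳ lt f g (Turn.f-lt t a∈) (Turn.f-lt t b∈) lk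
      ... | inj₁ lk₁ = crossed (proj₁ (kept a∈)) (proj₁ (kept b∈)) (proj₁ (kept x∈)) f∈
                         ab xf (a≢x ∘ lab′-cong) lk₁
        where open Turn t
      ... | inj₂ lk₂ = subst xS
          (trans (cong (λ h → (h ℤ.- alt a) ℤ.+ (alt x ℤ.- alt f)) flat) (telescope (alt f) (alt a) (alt x)))
          (x-PairOK (clr f) (clr x)
            (crossed (proj₁ (kept a∈)) (proj₁ (kept b∈)) g∈ (proj₁ (kept y∈)) ab (sym yg)
              (λ ag → a≢x (trans (lab′-cong ag) (trans (sym fg) (lab′-cong (sym xf))))) lk₂)
            (pairs f∈ (proj₁ (kept x∈)) (x≢f ∘ sym) (sym xf)))
        where
        open Turn t
        telescope : ∀ f a x → (f ℤ.- a) ℤ.+ (x ℤ.- f) ≡ x ℤ.- a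
        telescope = solve-∀

      merged-both : ∀ {x y} → lab x ≡ lab f ⊎ lab x ≡ lab g → lab y ≡ lab f ⊎ lab y ≡ lab g →
                    lab′ x ≡ lab′ y
      merged-both x y = trans (toF x) (sym (toF y))
        where
        toF : ∀ {x} → lab x ≡ lab f ⊎ lab x ≡ lab g → lab′ x ≡ lab′ f
        toF (inj₁ xf) = lab′-cong xf
        toF (inj₂ xg) = trans (lab′-cong xg) (sym glued)

      crossed′ : ∀ {a b x y} → A′ a → A′ b → A′ x → A′ y →
                 lab′ a ≡ lab′ b → lab′ x ≡ lab′ y → lab′ a ≢ lab′ x →
                 links lt a b x y ≡ true → xS (alt x ℤ.- alt a)
      crossed′ a∈ b∈ x∈ y∈ ab xy a≢x lk
        with merge-reflects (lab f) (lab g) ab | merge-reflects (lab f) (lab g) xy | kept a∈ | kept x∈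
      ... | inj₁ ab′ | inj₁ xy′ | _ | _ =
        crossed (proj₁ (kept a∈)) (proj₁ (kept b∈)) (proj₁ (kept x∈)) (proj₁ (kept y∈)) ab′ xy′
          (a≢x ∘ lab′-cong) lk
      ... | inj₂ (inj₁ (af , bg)) | inj₁ xy′ | _ , a≢f , _ | _ =
        crossed-via turn glued a∈ b∈ x∈ y∈ a≢f af bg xy′ a≢x lk
      ... | inj₂ (inj₂ (ag , bf)) | inj₁ xy′ | _ , _ , a≢g | _ =
        crossed-via (Turn-sym turn) (sym glued) a∈ b∈ x∈ y∈ a≢g ag bf xy′ a≢x lk
      ... | inj₁ ab′ | inj₂ (inj₁ (xf , yg)) | _ | _ , x≢f , _ =
        crossed-via′ turn glued a∈ b∈ x∈ y∈ x≢f xf yg ab′ a≢x lk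
      ... | inj₁ ab′ | inj₂ (inj₂ (xg , yf)) | _ | _ , _ , x≢g =
        crossed-via′ (Turn-sym turn) (sym glued) a∈ b∈ x∈ y∈ x≢g xg yf ab′ a≢x lk
      -- From here on both chords belong to the merged block, contrary to `a≢x`.
      ... | inj₂ (inj₁ (af , _)) | inj₂ (inj₁ (xf , _)) | _ | _ =
        contradiction (merged-both (inj₁ af) (inj₁ xf)) a≢x
      ... | inj₂ (inj₁ (af , _)) | inj₂ (inj₂ (xg , _)) | _ | _ =
        contradiction (merged-both (inj₁ af) (inj₂ xg)) a≢x
      ... | inj₂ (inj₂ (ag , _)) | inj₂ (inj₁ (xf , _)) | _ | _ =
        contradiction (merged-both (inj₂ ag) (inj₁ xf)) a≢x
      ... | inj₂ (inj₂ (ag , _)) | inj₂ (inj₂ (xg , _)) | _ | _ =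
        contradiction (merged-both (inj₂ ag) (inj₂ xg)) a≢x

      pairs′ : ∀ {x y} → A′ x → A′ y → x ≢ y → lab′ x ≡ lab′ y →
               PairOK (clr x) (clr y) (alt y ℤ.- alt x)
      pairs′ x∈ y∈ x≢y eq with joined x∈ y∈ eq
      ... | same xy = pairs (proj₁ (kept x∈)) (proj₁ (kept y∈)) x≢y xy
      ... | via t _ x≢f y≢g xf yg = pairOK-via t (proj₁ (kept x∈)) (proj₁ (kept y∈)) x≢f y≢g xf yg

      -- In `bounded′` the point `z` is `f` or `g`: the block of an erased point has room for only
      -- one survivor, so the merged block keeps at most one point from each side.
      third : Bounded κ → ∀ {x y z} → A x → A y → A z → x ≢ z → y ≢ z →
              lab x ≡ lab z → lab y ≡ lab z → x ≡ y
      third b x∈ y∈ z∈ x≢z y≢z xz yz with bounded b x∈ y∈ z∈ (trans xz (sym yz)) xz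
      ... | inj₁ x≡y        = x≡y
      ... | inj₂ (inj₁ x≡z) = contradiction x≡z x≢z
      ... | inj₂ (inj₂ y≡z) = contradiction y≡z y≢z

      bounded′ : Bounded κ → ∀ {x y z} → A′ x → A′ y → A′ z →
                 lab′ x ≡ lab′ y → lab′ x ≡ lab′ z → x ≡ y ⊎ x ≡ z ⊎ y ≡ z
      bounded′ b {x} {y} {z} x∈ y∈ z∈ xy xz with kept x∈ | kept y∈ | kept z∈
      ... | x∈A , x≢f , x≢g | y∈A , y≢f , y≢g | z∈A , z≢f , z≢g =
        cases (merge-reflects (lab f) (lab g) xy) (merge-reflects (lab f) (lab g) xz)
        where
        open Turn turn
        Related : V → V → Set
        Related u v = lab u ≡ lab v ⊎ (lab u ≡ lab f × lab v ≡ lab g) ⊎ (lab u ≡ lab g × lab v ≡ lab f)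
        cases : Related x y → Related x z → x ≡ y ⊎ x ≡ z ⊎ y ≡ z
        cases (inj₁ xy) (inj₁ xz) = bounded b x∈A y∈A z∈A xy xz
        cases (inj₁ xy) (inj₂ (inj₁ (xf , zg))) = inj₁ (third b x∈A y∈A f∈ x≢f y≢f xf (trans (sym xy) xf))
        cases (inj₁ xy) (inj₂ (inj₂ (xg , zf))) = inj₁ (third b x∈A y∈A g∈ x≢g y≢g xg (trans (sym xy) xg))
        cases (inj₂ (inj₁ (xf , yg))) (inj₁ xz) = inj₂ (inj₁ (third b x∈A z∈A f∈ x≢f z≢f xf (trans (sym xz) xf)))
        cases (inj₂ (inj₂ (xg , yf))) (inj₁ xz) = inj₂ (inj₁ (third b x∈A z∈A g∈ x≢g z≢g xg (trans (sym xz) xg)))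
        cases (inj₂ (inj₁ (xf , yg))) (inj₂ (inj₁ (_ , zg))) = inj₂ (inj₂ (third b y∈A z∈A g∈ y≢g z≢g yg zg))
        cases (inj₂ (inj₁ (xf , yg))) (inj₂ (inj₂ (xg , zf))) = inj₂ (inj₁ (third b x∈A z∈A f∈ x≢f z≢f xf zf))
        cases (inj₂ (inj₂ (xg , yf))) (inj₂ (inj₁ (xf , zg))) = inj₂ (inj₁ (third b x∈A z∈A g∈ x≢g z≢g xg zg))
        cases (inj₂ (inj₂ (xg , yf))) (inj₂ (inj₂ (_ , zf))) = inj₂ (inj₂ (third b y∈A z∈A f∈ y≢f z≢f yf zf))

      -- The points `x` and `f` already fill their block, so `g` lies in a different one. The other
      -- point of that block survives and becomes the new partner of `x`.
      partner-via : ∀ {f g x} → Paired κ → A f → A g → f ≢ g → A x → x ≢ f → x ≢ g → lab x ≡ lab f →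
                    ∃[ y ] (A y × y ≢ f × y ≢ g × y ≢ x × lab y ≡ lab g)
      partner-via {f} {g} {x} pr f∈ g∈ f≢g x∈ x≢f x≢g xf with partner pr g∈
      ... | y , y∈ , y≢g , yg = y , y∈ , y≢f , y≢g , y≢x , yg
        where
        f≁g : lab f ≢ lab g
        f≁g fg = f≢g (sym (third (paired⇒bounded κ pr) g∈ f∈ x∈ (x≢g ∘ sym) (x≢f ∘ sym)
                   (trans (sym fg) (sym xf)) (sym xf)))
        y≢f : y ≢ f
        y≢f refl = f≁g yg
        y≢x : y ≢ x
        y≢x refl = f≁g (trans (sym xf) yg)

      partner′ : Paired κ → ∀ {x} → A′ x → ∃[ y ] (A′ y × y ≢ x × lab′ y ≡ lab′ x)
      partner′ pr {x} x∈′ = find (kept x∈′) (lab x ≟ lab f) (lab x ≟ lab g)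
        where
        open Turn turn
        find : A x × x ≢ f × x ≢ g → Dec (lab x ≡ lab f) → Dec (lab x ≡ lab g) →
               ∃[ y ] (A′ y × y ≢ x × lab′ y ≡ lab′ x)
        find (x∈ , x≢f , x≢g) (yes xf) _ =
          let y , y∈ , y≢f , y≢g , y≢x , yg = partner-via pr f∈ g∈ f≢g x∈ x≢f x≢g xf
          in y , keep y∈ y≢f y≢g , y≢x , merged-both (inj₂ yg) (inj₁ xf)
        find (x∈ , x≢f , x≢g) (no _) (yes xg) =
          let y , y∈ , y≢g , y≢f , y≢x , yf = partner-via pr g∈ f∈ (f≢g ∘ sym) x∈ x≢g x≢f xg
          in y , keep y∈ y≢f y≢g , y≢x , merged-both (inj₁ yf) (inj₂ xg)
        find (x∈ , _ , _) (no x≁f) (no x≁g) with partner pr x∈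
        ... | y , y∈ , y≢x , yx =
          y , keep y∈ (λ { refl → x≁f (sym yx) }) (λ { refl → x≁g (sym yx) }) , y≢x , lab′-cong yx

      admissible′ : Admissible A′ erased
      admissible′ = record { bounded = bounded′ ; partner = partner′ ; pairs = pairs′ ; crossed = crossed′ }

-- Category operations

Everything : ∀ {V : Set} → V → Set
Everything _ = ⊤

isLower : ∀ {k l} → Pt k l → Bool
isLower (inj₁ _) = true
isLower (inj₂ _) = false

links-cong : ∀ {V W : Set} (lt : V → V → Bool) (lt′ : W → W → Bool) (φ : V → W) →
             (∀ x y → lt x y ≡ lt′ (φ x) (φ y)) → ∀ a b x y →
             links lt a b x y ≡ links lt′ (φ a) (φ b) (φ x) (φ y)
links-cong lt lt′ φ eq a b x y =
  cong₂ _xor_ (cong₂ _xor_ (eq a x) (eq b x)) (cong₂ _xor_ (eq a y) (eq b y))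

xor-not : ∀ p q → not p xor not q ≡ p xor q
xor-not true  true  = refl
xor-not true  false = refl
xor-not false true  = refl
xor-not false false = refl

-- The points of the second diagram come as one interval, whose place among
-- the points of the first is given by β; c is the height at which it starts.
juxtapose : ∀ {V W : Set} → (V → Bool) → ℤ → Diagram V → Diagram W → Diagram (V ⊎ W)
juxtapose {V} {W} β c d e = record
  { lab = [ (λ v → 2 ℕ.* D.lab v) , (λ w → suc (2 ℕ.* E.lab w)) ]
  ; lt  = lt
  ; clr = [ D.clr , E.clr ]
  ; alt = [ D.alt , (λ w → c ℤ.+ E.alt w) ]
  }
  where
  module D = Diagram d
  module E = Diagram e
  lt : V ⊎ W → V ⊎ W → Bool
  lt (inj₁ v) (inj₁ v′) = D.lt v v′
  lt (inj₁ v) (inj₂ _)  = β v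
  lt (inj₂ _) (inj₁ v)  = not (β v)
  lt (inj₂ w) (inj₂ w′) = E.lt w w′

double-injective : ∀ {m n} → 2 ℕ.* m ≡ 2 ℕ.* n → m ≡ n
double-injective {m} {n} = ℕₚ.*-cancelˡ-≡ m n 2

odd-injective : ∀ {m n} → suc (2 ℕ.* m) ≡ suc (2 ℕ.* n) → m ≡ n
odd-injective = double-injective ∘ ℕₚ.suc-injective

module _ (Q : Tuple) (laws : Laws Q) (κ : Size) where
  open Tuple Q
  open Laws laws
  open Theory Q laws κ

  Admitted : ∀ {k l} → Part k l → Set
  Admitted p = Admissible Everything (diagram p) × sS (Σp p)

  -- An identification of `W` with the points of `V` satisfying `A`, weak enough to include
  -- reflections. Colours are compared only through `PairOK`, because the involution inverts all of
  -- them. Links are compared only between different blocks, because reversing the order negates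
  -- comparisons of distinct points only. Heights may move by elements of `sS`.
  record Embedding {V W : Set} (A : V → Set) (d : Diagram V) (e : Diagram W) : Set where
    private
      module D = Diagram d
      module E = Diagram e
    field
      φ           : W → V
      φ-∈         : ∀ w → A (φ w)
      φ-injective : ∀ {x y} → φ x ≡ φ y → x ≡ y
      φ-onto      : ∀ v → A v → ∃[ w ] φ w ≡ v
      lab-to      : ∀ {x y} → E.lab x ≡ E.lab y → D.lab (φ x) ≡ D.lab (φ y)
      lab-from    : ∀ {x y} → D.lab (φ x) ≡ D.lab (φ y) → E.lab x ≡ E.lab y
      φ-links     : ∀ {a b x y} → E.lab a ≡ E.lab b → E.lab x ≡ E.lab y → E.lab a ≢ E.lab x →
                    links E.lt a b x y ≡ links D.lt (φ a) (φ b) (φ x) (φ y)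
      φ-clr       : ∀ x y {z} → PairOK Q (D.clr (φ x)) (D.clr (φ y)) z → PairOK Q (E.clr x) (E.clr y) z
      shift       : W → ℤ
      shift-∈     : ∀ w → sS (shift w)
      φ-alt       : ∀ w → E.alt w ≡ D.alt (φ w) ℤ.+ shift w

    diff-shift : ∀ x y → ∃[ s ] (sS s × (D.alt (φ y) ℤ.- D.alt (φ x)) ℤ.+ s ≡ E.alt y ℤ.- E.alt x)
    diff-shift x y = shift y ℤ.- shift x , s-+ (shift-∈ y) (s-neg (shift-∈ x)) ,
      trans (regroup (D.alt (φ x)) (D.alt (φ y)) (shift x) (shift y)) (sym (cong₂ ℤ._-_ (φ-alt y) (φ-alt x)))
      where
      regroup : ∀ a b s t → (b ℤ.- a) ℤ.+ (t ℤ.- s) ≡ (b ℤ.+ t) ℤ.- (a ℤ.+ s)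
      regroup = solve-∀

    transport : Admissible A d → Admissible Everything e
    transport adm = record { bounded = bounded′ ; partner = partner′ ; pairs = pairs′ ; crossed = crossed′ }
      where
      open Admissible adm
      bounded′ : Bounded κ → ∀ {x y z} → ⊤ → ⊤ → ⊤ →
                 E.lab x ≡ E.lab y → E.lab x ≡ E.lab z → x ≡ y ⊎ x ≡ z ⊎ y ≡ z
      bounded′ b {x} {y} {z} _ _ _ xy xz
        with bounded b (φ-∈ x) (φ-∈ y) (φ-∈ z) (lab-to xy) (lab-to xz)
      ... | inj₁ eq        = inj₁ (φ-injective eq)
      ... | inj₂ (inj₁ eq) = inj₂ (inj₁ (φ-injective eq))
      ... | inj₂ (inj₂ eq) = inj₂ (inj₂ (φ-injective eq))
      partner′ : Paired κ → ∀ {x} → ⊤ → ∃[ y ] (⊤ × y ≢ x × E.lab y ≡ E.lab x)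
      partner′ pr {x} _ with partner pr (φ-∈ x)
      ... | v , v∈ , v≢ , vx with φ-onto v v∈
      ...   | w , refl = w , tt , v≢ ∘ cong φ , lab-from vx
      pairs′ : ∀ {x y} → ⊤ → ⊤ → x ≢ y → E.lab x ≡ E.lab y →
               PairOK Q (E.clr x) (E.clr y) (E.alt y ℤ.- E.alt x)
      pairs′ {x} {y} _ _ x≢y xy with diff-shift x y
      ... | s , s∈ , eq = φ-clr x y (subst (PairOK Q (D.clr (φ x)) (D.clr (φ y))) eq (PairOK-shift (D.clr (φ x)) (D.clr (φ y))
        (pairs (φ-∈ x) (φ-∈ y) (x≢y ∘ φ-injective) (lab-to xy)) s∈))
      crossed′ : ∀ {a b x y} → ⊤ → ⊤ → ⊤ → ⊤ → E.lab a ≡ E.lab b → E.lab x ≡ E.lab y →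
                 E.lab a ≢ E.lab x → links E.lt a b x y ≡ true → xS (E.alt x ℤ.- E.alt a)
      crossed′ {a} {b} {x} {y} _ _ _ _ ab xy a≢x lk with diff-shift a x
      ... | s , s∈ , eq = subst xS eq (x-shift
        (crossed (φ-∈ a) (φ-∈ b) (φ-∈ x) (φ-∈ y) (lab-to ab) (lab-to xy) (a≢x ∘ lab-from)
          (trans (sym (φ-links ab xy a≢x)) lk)) s∈)

  module _ {V W : Set} (β : V → Bool) (c : ℤ) {d : Diagram V} {e : Diagram W}
    (admᵈ : Admissible Everything d) (admᵉ : Admissible Everything e) where
    private
      module D = Diagram d
      module E = Diagram e
      module Dₐ = Admissible admᵈ
      module Eₐ = Admissible admᵉ
      J : Diagram (V ⊎ W)
      J = juxtapose β c d e
      module J = Diagram J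

    private
      cancel-start : ∀ x y → y ℤ.- x ≡ (c ℤ.+ y) ℤ.- (c ℤ.+ x)
      cancel-start = lemma c
        where
        lemma : ∀ c x y → y ℤ.- x ≡ (c ℤ.+ y) ℤ.- (c ℤ.+ x)
        lemma = solve-∀

      boundedᴶ : Bounded κ → ∀ x y z → J.lab x ≡ J.lab y → J.lab x ≡ J.lab z → x ≡ y ⊎ x ≡ z ⊎ y ≡ z
      boundedᴶ b (inj₁ x) (inj₁ y) (inj₁ z) xy xz
        with Dₐ.bounded b {x} {y} {z} tt tt tt (double-injective xy) (double-injective xz)
      ... | inj₁ eq        = inj₁ (cong inj₁ eq)
      ... | inj₂ (inj₁ eq) = inj₂ (inj₁ (cong inj₁ eq))
      ... | inj₂ (inj₂ eq) = inj₂ (inj₂ (cong inj₁ eq))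
      boundedᴶ b (inj₂ x) (inj₂ y) (inj₂ z) xy xz
        with Eₐ.bounded b {x} {y} {z} tt tt tt (odd-injective xy) (odd-injective xz)
      ... | inj₁ eq        = inj₁ (cong inj₂ eq)
      ... | inj₂ (inj₁ eq) = inj₂ (inj₁ (cong inj₂ eq))
      ... | inj₂ (inj₂ eq) = inj₂ (inj₂ (cong inj₂ eq))
      boundedᴶ b (inj₁ x) (inj₂ y) z xy xz = contradiction xy (ℕₚ.even≢odd (D.lab x) (E.lab y))
      boundedᴶ b (inj₂ x) (inj₁ y) z xy xz = contradiction (sym xy) (ℕₚ.even≢odd (D.lab y) (E.lab x))
      boundedᴶ b (inj₁ x) (inj₁ y) (inj₂ z) xy xz = contradiction xz (ℕₚ.even≢odd (D.lab x) (E.lab z))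
      boundedᴶ b (inj₂ x) (inj₂ y) (inj₁ z) xy xz = contradiction (sym xz) (ℕₚ.even≢odd (D.lab z) (E.lab x))

      partnerᴶ : Paired κ → ∀ x → ∃[ y ] (⊤ × y ≢ x × J.lab y ≡ J.lab x)
      partnerᴶ pr (inj₁ x) with Dₐ.partner pr {x} tt
      ... | y , _ , y≢x , yx = inj₁ y , tt , (λ { refl → y≢x refl }) , cong (2 ℕ.*_) yx
      partnerᴶ pr (inj₂ x) with Eₐ.partner pr {x} tt
      ... | y , _ , y≢x , yx = inj₂ y , tt , (λ { refl → y≢x refl }) , cong (λ n → suc (2 ℕ.* n)) yx

      pairsᴶ : ∀ x y → x ≢ y → J.lab x ≡ J.lab y → PairOK Q (J.clr x) (J.clr y) (J.alt y ℤ.- J.alt x)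
      pairsᴶ (inj₁ x) (inj₁ y) x≢y xy = Dₐ.pairs tt tt (x≢y ∘ cong inj₁) (double-injective xy)
      pairsᴶ (inj₂ x) (inj₂ y) x≢y xy = subst (PairOK Q (E.clr x) (E.clr y)) (cancel-start (E.alt x) (E.alt y))
        (Eₐ.pairs tt tt (x≢y ∘ cong inj₂) (odd-injective xy))
      pairsᴶ (inj₁ x) (inj₂ y) x≢y xy = contradiction xy (ℕₚ.even≢odd (D.lab x) (E.lab y))
      pairsᴶ (inj₂ x) (inj₁ y) x≢y xy = contradiction (sym xy) (ℕₚ.even≢odd (D.lab y) (E.lab x))

      crossedᴶ : ∀ a b x y → J.lab a ≡ J.lab b → J.lab x ≡ J.lab y → J.lab a ≢ J.lab x →
                 links J.lt a b x y ≡ true → xS (J.alt x ℤ.- J.alt a)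
      crossedᴶ (inj₁ a) (inj₁ b) (inj₁ x) (inj₁ y) ab xy a≢x lk =
        Dₐ.crossed tt tt tt tt (double-injective ab) (double-injective xy) (a≢x ∘ cong (2 ℕ.*_)) lk
      crossedᴶ (inj₂ a) (inj₂ b) (inj₂ x) (inj₂ y) ab xy a≢x lk =
        subst xS (cancel-start (E.alt a) (E.alt x))
          (Eₐ.crossed tt tt tt tt (odd-injective ab) (odd-injective xy) (a≢x ∘ cong (λ n → suc (2 ℕ.* n))) lk)
      -- The second diagram occupies one interval, so `x` and `y` compare alike with `a` and with
      -- `b`, and the two halves of the sum cancel.
      crossedᴶ (inj₁ a) (inj₁ b) (inj₂ x) (inj₂ y) ab xy a≢x lk =
        contradiction (trans (sym lk) (xor-same (β a xor β b))) λ ()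
      crossedᴶ (inj₂ a) (inj₂ b) (inj₁ x) (inj₁ y) ab xy a≢x lk =
        contradiction (trans (sym lk) (cong₂ _xor_ (xor-same (not (β x))) (xor-same (not (β y))))) λ ()
      crossedᴶ (inj₁ a) (inj₂ b) _ _ ab = contradiction ab (ℕₚ.even≢odd (D.lab a) (E.lab b))
      crossedᴶ (inj₂ a) (inj₁ b) _ _ ab = contradiction (sym ab) (ℕₚ.even≢odd (D.lab b) (E.lab a))
      crossedᴶ _ _ (inj₁ x) (inj₂ y) ab xy = contradiction xy (ℕₚ.even≢odd (D.lab x) (E.lab y))
      crossedᴶ _ _ (inj₂ x) (inj₁ y) ab xy = contradiction (sym xy) (ℕₚ.even≢odd (D.lab y) (E.lab x))

    juxtapose-admissible : Admissible Everything (juxtapose β c d e)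
    juxtapose-admissible = record
      { bounded = λ b {x} {y} {z} _ _ _ → boundedᴶ b x y z
      ; partner = λ pr {x} _ → partnerᴶ pr x
      ; pairs   = λ {x} {y} _ _ → pairsᴶ x y
      ; crossed = λ {a} {b} {x} {y} _ _ _ _ → crossedᴶ a b x y
      }

  -- The involution reverses the order and inverts every normalized colour, but keeps the heights,
  -- as `ht` reads both rows from left to right.
  invol-admitted : ∀ {k l} (p : Part k l) → Admitted p → Admitted (p *)
  invol-admitted {k} {l} p (adm , s) = Embedding.transport embedding adm , subst sS (sym Σ*) (s-neg s)
    where
    Σ* : Σp (p *) ≡ - Σp p
    Σ* = trans (Σp-rows (p *)) (trans (flip (total (upper p)) (total (lower p))) (cong -_ (sym (Σp-rows p))))
      where
      flip : ∀ a b → a ℤ.- b ≡ - (b ℤ.- a)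
      flip = solve-∀
    swapPt-injective : ∀ {x y : Pt l k} → swapPt x ≡ swapPt y → x ≡ y
    swapPt-injective {inj₁ _} {inj₁ _} refl = refl
    swapPt-injective {inj₂ _} {inj₂ _} refl = refl
    before-* : ∀ x y → before x y ≡ before (swapPt y) (swapPt x)
    before-* (inj₁ _) (inj₁ _) = refl
    before-* (inj₁ _) (inj₂ _) = refl
    before-* (inj₂ _) (inj₁ _) = refl
    before-* (inj₂ _) (inj₂ _) = refl
    before-*-not : ∀ {x y} → blk (p *) x ≢ blk (p *) y → before x y ≡ not (before (swapPt x) (swapPt y))
    before-*-not {x} {y} x≢y =
      trans (before-* x y) (before-swap {α = swapPt y} {swapPt x} (x≢y ∘ cong (blk p) ∘ sym))
    links-* : ∀ {a b x y} → blk (p *) a ≡ blk (p *) b → blk (p *) x ≡ blk (p *) y →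
              blk (p *) a ≢ blk (p *) x →
              links before a b x y ≡ links before (swapPt a) (swapPt b) (swapPt x) (swapPt y)
    links-* {a} {b} {x} {y} ab xy a≢x = cong₂ _xor_
      (trans (cong₂ _xor_ (before-*-not a≢x) (before-*-not b≢x))
        (xor-not (before (swapPt a) (swapPt x)) (before (swapPt b) (swapPt x))))
      (trans (cong₂ _xor_ (before-*-not a≢y) (before-*-not b≢y))
        (xor-not (before (swapPt a) (swapPt y)) (before (swapPt b) (swapPt y))))
      where
      b≢x : blk (p *) b ≢ blk (p *) x
      b≢x bx = a≢x (trans ab bx)
      a≢y : blk (p *) a ≢ blk (p *) y
      a≢y ay = a≢x (trans ay (sym xy))
      b≢y : blk (p *) b ≢ blk (p *) y
      b≢y by = a≢y (trans ab by)
    ncol-* : ∀ x → inv (ncol p (swapPt x)) ≡ ncol (p *) x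
    ncol-* (inj₁ i) = inv-inv _
    ncol-* (inj₂ j) = refl
    onto : ∀ v → ⊤ → ∃[ w ] swapPt w ≡ v
    onto (inj₁ i) _ = inj₂ i , refl
    onto (inj₂ j) _ = inj₁ j , refl
    ht-* : ∀ x → ht (p *) x ≡ ht p (swapPt x) ℤ.+ 0ℤ
    ht-* (inj₁ i) = sym (ℤₚ.+-identityʳ _)
    ht-* (inj₂ j) = sym (ℤₚ.+-identityʳ _)
    embedding : Embedding Everything (diagram p) (diagram (p *))
    embedding = record
      { φ = swapPt ; φ-∈ = λ _ → tt ; φ-injective = swapPt-injective ; φ-onto = onto
      ; lab-to = id ; lab-from = id ; φ-links = links-*
      ; φ-clr = λ x y ok → subst (λ c → PairOK Q c (ncol (p *) y) _) (ncol-* x)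
                  (subst (λ c → PairOK Q (inv (ncol p (swapPt x))) c _) (ncol-* y)
                    (PairOK-inv (ncol p (swapPt x)) (ncol p (swapPt y)) ok))
      ; shift = λ _ → 0ℤ ; shift-∈ = λ _ → s-0 ; φ-alt = ht-*
      }

-- Tensor product and composition

module _ (Q : Tuple) (laws : Laws Q) (κ : Size) where
  open Tuple Q
  open Laws laws
  open Theory Q laws κ

  module _ {k l k′ l′} (p : Part k l) (q : Part k′ l′) where
    private
      J : Diagram (Pt k l ⊎ Pt k′ l′)
      -- On the circle of `p ⊗ q` all points of `q` lie between the lower and the upper row of `p`,
      -- where the walk of `p` has reached `total (lower p)`.
      J = juxtapose isLower (total (lower p)) (diagram p) (diagram q)
      module J = Diagram J

      φ : Pt (k + k′) (l + l′) → Pt k l ⊎ Pt k′ l′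
      φ (inj₁ i) = [ inj₁ ∘ inj₁ , inj₂ ∘ inj₁ ] (splitAt k i)
      φ (inj₂ j) = [ inj₁ ∘ inj₂ , inj₂ ∘ inj₂ ] (splitAt l j)

      ψ : Pt k l ⊎ Pt k′ l′ → Pt (k + k′) (l + l′)
      ψ (inj₁ (inj₁ a)) = inj₁ (a ↑ˡ k′)
      ψ (inj₁ (inj₂ a)) = inj₂ (a ↑ˡ l′)
      ψ (inj₂ (inj₁ b)) = inj₁ (k ↑ʳ b)
      ψ (inj₂ (inj₂ b)) = inj₂ (l ↑ʳ b)

      φ-ψ : ∀ v → φ (ψ v) ≡ v
      φ-ψ (inj₁ (inj₁ a)) = cong [ inj₁ ∘ inj₁ , inj₂ ∘ inj₁ ] (Finₚ.splitAt-↑ˡ k a k′)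
      φ-ψ (inj₁ (inj₂ a)) = cong [ inj₁ ∘ inj₂ , inj₂ ∘ inj₂ ] (Finₚ.splitAt-↑ˡ l a l′)
      φ-ψ (inj₂ (inj₁ b)) = cong [ inj₁ ∘ inj₁ , inj₂ ∘ inj₁ ] (Finₚ.splitAt-↑ʳ k k′ b)
      φ-ψ (inj₂ (inj₂ b)) = cong [ inj₁ ∘ inj₂ , inj₂ ∘ inj₂ ] (Finₚ.splitAt-↑ʳ l l′ b)

      ψ-φ : ∀ x → ψ (φ x) ≡ x
      ψ-φ (inj₁ i) with splitAt k i in eq
      ... | inj₁ a = cong inj₁ (Finₚ.splitAt⁻¹-↑ˡ eq)
      ... | inj₂ b = cong inj₁ (Finₚ.splitAt⁻¹-↑ʳ eq)
      ψ-φ (inj₂ j) with splitAt l j in eq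
      ... | inj₁ a = cong inj₂ (Finₚ.splitAt⁻¹-↑ˡ eq)
      ... | inj₂ b = cong inj₂ (Finₚ.splitAt⁻¹-↑ʳ eq)

      blk-φ : ∀ x → blk (p ⊗ q) x ≡ J.lab (φ x)
      blk-φ (inj₁ i) with splitAt k i
      ... | inj₁ _ = refl
      ... | inj₂ _ = refl
      blk-φ (inj₂ j) with splitAt l j
      ... | inj₁ _ = refl
      ... | inj₂ _ = refl

      ncol-φ : ∀ x → ncol (p ⊗ q) x ≡ J.clr (φ x)
      ncol-φ (inj₁ i) with splitAt k i
      ... | inj₁ _ = refl
      ... | inj₂ _ = refl
      ncol-φ (inj₂ j) with splitAt l j
      ... | inj₁ _ = refl
      ... | inj₂ _ = refl

      split-< : ∀ m {n} (i : Fin m) (j : Fin n) → (toℕ i <ᵇ m + toℕ j) ≡ true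
      split-< m i j = <ᵇ-true (ℕₚ.≤-trans (toℕ<n i) (ℕₚ.m≤m+n m (toℕ j)))

      split-> : ∀ m {n} (i : Fin m) (j : Fin n) → (m + toℕ j <ᵇ toℕ i) ≡ false
      split-> m i j = <ᵇ-false (ℕₚ.≤-trans (ℕₚ.<⇒≤ (toℕ<n i)) (ℕₚ.m≤m+n m (toℕ j)))

      shift-<ᵇ : ∀ m a b → (m + a <ᵇ m + b) ≡ (a <ᵇ b)
      shift-<ᵇ m a b = <ᵇ-cong (ℕₚ.+-cancelˡ-< m a b) (ℕₚ.+-monoʳ-< m)

      before-φ : ∀ x y → before x y ≡ J.lt (φ x) (φ y)
      before-φ (inj₁ i) (inj₁ j) with splitAt k i in ei | splitAt k j in ej
      ... | inj₁ a | inj₁ b = cong₂ _<ᵇ_ (toℕ-splitAtˡ k i ei) (toℕ-splitAtˡ k j ej)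
      ... | inj₁ a | inj₂ b = trans (cong₂ _<ᵇ_ (toℕ-splitAtˡ k i ei) (toℕ-splitAtʳ k j ej)) (split-< k a b)
      ... | inj₂ a | inj₁ b = trans (cong₂ _<ᵇ_ (toℕ-splitAtʳ k i ei) (toℕ-splitAtˡ k j ej)) (split-> k b a)
      ... | inj₂ a | inj₂ b = trans (cong₂ _<ᵇ_ (toℕ-splitAtʳ k i ei) (toℕ-splitAtʳ k j ej))
                                    (shift-<ᵇ k (toℕ a) (toℕ b))
      before-φ (inj₁ i) (inj₂ j) with splitAt k i | splitAt l j
      ... | inj₁ _ | inj₁ _ = refl
      ... | inj₁ _ | inj₂ _ = refl
      ... | inj₂ _ | inj₁ _ = refl
      ... | inj₂ _ | inj₂ _ = refl
      before-φ (inj₂ i) (inj₁ j) with splitAt l i | splitAt k j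
      ... | inj₁ _ | inj₁ _ = refl
      ... | inj₁ _ | inj₂ _ = refl
      ... | inj₂ _ | inj₁ _ = refl
      ... | inj₂ _ | inj₂ _ = refl
      before-φ (inj₂ i) (inj₂ j) with splitAt l i in ei | splitAt l j in ej
      ... | inj₁ a | inj₁ b = cong₂ _<ᵇ_ (toℕ-splitAtˡ l j ej) (toℕ-splitAtˡ l i ei)
      ... | inj₁ a | inj₂ b = trans (cong₂ _<ᵇ_ (toℕ-splitAtʳ l j ej) (toℕ-splitAtˡ l i ei)) (split-> l a b)
      ... | inj₂ a | inj₁ b = trans (cong₂ _<ᵇ_ (toℕ-splitAtˡ l j ej) (toℕ-splitAtʳ l i ei)) (split-< l b a)
      ... | inj₂ a | inj₂ b = trans (cong₂ _<ᵇ_ (toℕ-splitAtʳ l j ej) (toℕ-splitAtʳ l i ei))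
                                    (shift-<ᵇ l (toℕ b) (toℕ a))

      shift : Pt (k + k′) (l + l′) → ℤ
      shift (inj₁ i) = 0ℤ
      shift (inj₂ j) = [ (λ _ → 0ℤ) , (λ _ → - Σp p) ] (splitAt l j)

      -- The upper points of q lie above total (upper p) = total (lower p) − Σp p.
      ht-φ : ∀ x → ht (p ⊗ q) x ≡ J.alt (φ x) ℤ.+ shift x
      ht-φ (inj₁ i) = trans (ht-lower (splitAt k i) refl) (sym (ℤₚ.+-identityʳ _))
        where
        ht-lower : ∀ s → splitAt k i ≡ s →
                   height (lower p ⧺ lower q) i ≡ J.alt ([ inj₁ ∘ inj₁ , inj₂ ∘ inj₁ ] s)
        ht-lower (inj₁ a) eq = height-⧺ˡ (lower p) (lower q) i eq
        ht-lower (inj₂ b) eq = height-⧺ʳ (lower p) (lower q) i eq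
      ht-φ (inj₂ j) = ht-upper (splitAt l j) refl
        where
        regroup : ∀ a b h → b ℤ.+ h ≡ (a ℤ.+ h) ℤ.+ - (a ℤ.- b)
        regroup = solve-∀
        ht-upper : ∀ s → splitAt l j ≡ s → height (upper p ⧺ upper q) j ≡
                   J.alt ([ inj₁ ∘ inj₂ , inj₂ ∘ inj₂ ] s) ℤ.+ [ (λ _ → 0ℤ) , (λ _ → - Σp p) ] s
        ht-upper (inj₁ a) eq = trans (height-⧺ˡ (upper p) (upper q) j eq) (sym (ℤₚ.+-identityʳ _))
        ht-upper (inj₂ b) eq = trans (height-⧺ʳ (upper p) (upper q) j eq)
          (trans (regroup (total (lower p)) (total (upper p)) (height (upper q) b))
                 (cong (λ z → (total (lower p) ℤ.+ height (upper q) b) ℤ.+ - z) (sym (Σp-rows p))))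

      Σ⊗ : Σp (p ⊗ q) ≡ Σp p ℤ.+ Σp q
      Σ⊗ = begin
        Σp (p ⊗ q)
          ≡⟨ Σp-rows (p ⊗ q) ⟩
        total (lower p ⧺ lower q) ℤ.- total (upper p ⧺ upper q)
          ≡⟨ cong₂ ℤ._-_ (total-⧺ (lower p) (lower q)) (total-⧺ (upper p) (upper q)) ⟩
        (total (lower p) ℤ.+ total (lower q)) ℤ.- (total (upper p) ℤ.+ total (upper q))
          ≡⟨ regroup (total (lower p)) (total (lower q)) (total (upper p)) (total (upper q)) ⟩
        (total (lower p) ℤ.- total (upper p)) ℤ.+ (total (lower q) ℤ.- total (upper q))
          ≡⟨ sym (cong₂ ℤ._+_ (Σp-rows p) (Σp-rows q)) ⟩
        Σp p ℤ.+ Σp q ∎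
        where
        open ≡-Reasoning
        regroup : ∀ a b c d → (a ℤ.+ b) ℤ.- (c ℤ.+ d) ≡ (a ℤ.- c) ℤ.+ (b ℤ.- d)
        regroup = solve-∀

    tensor-admitted : Admitted Q laws κ p → Admitted Q laws κ q → Admitted Q laws κ (p ⊗ q)
    tensor-admitted (admᵖ , sᵖ) (admᵠ , sᵠ) =
      Embedding.transport embedding (juxtapose-admissible Q laws κ isLower (total (lower p)) admᵖ admᵠ) ,
      subst sS (sym Σ⊗) (s-+ sᵖ sᵠ)
      where
      shift-∈ : ∀ x → sS (shift x)
      shift-∈ (inj₁ i) = s-0
      shift-∈ (inj₂ j) with splitAt l j
      ... | inj₁ _ = s-0
      ... | inj₂ _ = s-neg sᵖ
      embedding : Embedding Q laws κ Everything J (diagram (p ⊗ q))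
      embedding = record
        { φ = φ ; φ-∈ = λ _ → tt
        ; φ-injective = λ {x} {y} eq → trans (sym (ψ-φ x)) (trans (cong ψ eq) (ψ-φ y))
        ; φ-onto = λ v _ → ψ v , φ-ψ v
        ; lab-to = λ {x} {y} eq → trans (sym (blk-φ x)) (trans eq (blk-φ y))
        ; lab-from = λ {x} {y} eq → trans (blk-φ x) (trans eq (sym (blk-φ y)))
        ; φ-links = λ {a} {b} {x} {y} _ _ _ → links-cong before J.lt φ before-φ a b x y
        ; φ-clr = λ x y → subst id (cong₂ (λ c c′ → PairOK Q c c′ _) (sym (ncol-φ x)) (sym (ncol-φ y)))
        ; shift = shift ; shift-∈ = shift-∈ ; φ-alt = ht-φ
        }

  module _ {k l n} (p : Part k l) (q : Part l n) (r : Part k n)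
    (composable : Composable p q) (composition : IsComposition p q r) where
    private
      V : Set
      V = Pt k l ⊎ Pt l n

      J : Diagram V
      -- Here `q` follows all of `p`, so the upper row of `p`, read from right to left, meets the
      -- lower row of `q` at rank 0. The starting height is 0 because both rows measure heights from
      -- their left ends, which makes identified points equally high.
      J = juxtapose (λ _ → true) 0ℤ (diagram p) (diagram q)
      module J = Diagram J

      relabel : (V → ℕ) → Diagram V
      relabel label = record J { lab = label }

      π : V → Pt3 k l n
      π (inj₁ a) = embP a
      π (inj₂ b) = embQ b

      leftMid rightMid : Fin l → V
      leftMid j  = inj₁ (inj₂ j)
      rightMid j = inj₂ (inj₁ j)

      -- The points left after the identified pairs of rank below i have been erased.
      -- The two copies of the point of rank i are then adjacent in the cyclic order.
      Alive : ℕ → V → Set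
      Alive i (inj₁ (inj₁ _)) = ⊤
      Alive i (inj₁ (inj₂ j)) = i ≤ toℕ j
      Alive i (inj₂ (inj₁ j)) = i ≤ toℕ j
      Alive i (inj₂ (inj₂ _)) = ⊤

      -- `coarser` and `glued` make the labels respect every edge of the composition, `connected`
      -- keeps them from identifying more than these edges do. When all middle points are erased,
      -- the labels therefore describe the blocks of `r`.
      record Stage (i : ℕ) : Set where
        field
          label      : V → ℕ
          admissible : Admissible (Alive i) (relabel label)
          coarser    : ∀ {x y} → J.lab x ≡ J.lab y → label x ≡ label y
          glued      : ∀ j → toℕ j < i → label (leftMid j) ≡ label (rightMid j)
          connected  : ∀ {x y} → label x ≡ label y → Star (CompEdge p q) (π x) (π y)

      -- Middle points of larger rank lie before both copies if they come from `p` and behind both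
      -- if they come from `q`, because the two rows are traversed in opposite directions.
      turn : ∀ j {label} → Turn (Alive (toℕ j)) (Alive (suc (toℕ j))) (relabel label)
                                (leftMid j) (rightMid j)
      turn j = record
        { f∈ = ℕₚ.≤-refl ; g∈ = ℕₚ.≤-refl ; f≢g = λ ()
        ; color = trans (sym (composable j)) (sym (inv-inv _))
        ; flat = trans (ℤₚ.+-identityˡ _) (height-cong (sym ∘ composable) j)
        ; lt-f = λ {y} → after y ; f-lt = λ {y} → ahead y
        }
        where
        after : ∀ y → Alive (suc (toℕ j)) y → J.lt (leftMid j) y ≡ J.lt (rightMid j) y
        after (inj₁ (inj₁ _)) _ = refl
        after (inj₁ (inj₂ i)) j<i = <ᵇ-false (ℕₚ.<⇒≤ j<i)
        after (inj₂ (inj₁ i)) j<i = sym (<ᵇ-true j<i)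
        after (inj₂ (inj₂ _)) _ = refl
        ahead : ∀ y → Alive (suc (toℕ j)) y → J.lt y (leftMid j) ≡ J.lt y (rightMid j)
        ahead (inj₁ (inj₁ _)) _ = refl
        ahead (inj₁ (inj₂ i)) j<i = <ᵇ-true j<i
        ahead (inj₂ (inj₁ i)) j<i = sym (<ᵇ-false (ℕₚ.<⇒≤ j<i))
        ahead (inj₂ (inj₂ _)) _ = refl

      kept : ∀ j {v} → Alive (suc (toℕ j)) v → Alive (toℕ j) v × v ≢ leftMid j × v ≢ rightMid j
      kept j {inj₁ (inj₁ _)} _   = tt , (λ ()) , (λ ())
      kept j {inj₁ (inj₂ i)} j<i = ℕₚ.<⇒≤ j<i , (λ { refl → ℕₚ.<-irrefl refl j<i }) , (λ ())
      kept j {inj₂ (inj₁ i)} j<i = ℕₚ.<⇒≤ j<i , (λ ()) , (λ { refl → ℕₚ.<-irrefl refl j<i })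
      kept j {inj₂ (inj₂ _)} _   = tt , (λ ()) , (λ ())

      keep : ∀ j {v} → Alive (toℕ j) v → v ≢ leftMid j → v ≢ rightMid j → Alive (suc (toℕ j)) v
      keep j {inj₁ (inj₁ _)} _ _ _ = tt
      keep j {inj₁ (inj₂ i)} j≤i ≢f _ = ℕₚ.≤∧≢⇒< j≤i (λ eq → ≢f (cong leftMid (toℕ-injective (sym eq))))
      keep j {inj₂ (inj₁ i)} j≤i _ ≢g = ℕₚ.≤∧≢⇒< j≤i (λ eq → ≢g (cong rightMid (toℕ-injective (sym eq))))
      keep j {inj₂ (inj₂ _)} _ _ _ = tt

      start : Admissible Everything J → Stage 0
      start adm = record
        { label = J.lab
        ; admissible = record
          { bounded = λ b _ _ _ → bounded b tt tt tt
          ; partner = λ pr _ → let y , _ , y≢x , yx = partner pr tt in y , alive y , y≢x , yx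
          ; pairs = λ _ _ → pairs tt tt
          ; crossed = λ {a} {b} {x} {y} _ _ _ _ → crossed {a} {b} {x} {y} tt tt tt tt
          }
        ; coarser = id ; glued = λ _ () ; connected = λ {x} {y} → connect x y
        }
        where
        open Admissible adm
        alive : ∀ y → Alive 0 y
        alive (inj₁ (inj₁ _)) = tt
        alive (inj₁ (inj₂ _)) = z≤n
        alive (inj₂ (inj₁ _)) = z≤n
        alive (inj₂ (inj₂ _)) = tt
        connect : ∀ x y → J.lab x ≡ J.lab y → Star (CompEdge p q) (π x) (π y)
        connect (inj₁ a) (inj₁ b) eq = viaP a b (double-injective eq) ◅ ε
        connect (inj₂ a) (inj₂ b) eq = viaQ a b (odd-injective eq) ◅ ε
        connect (inj₁ a) (inj₂ b) eq = contradiction eq (ℕₚ.even≢odd (blk p a) (blk q b))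
        connect (inj₂ a) (inj₁ b) eq = contradiction (sym eq) (ℕₚ.even≢odd (blk p b) (blk q a))

      advance : ∀ j → Stage (toℕ j) → Stage (suc (toℕ j))
      advance j stage = record
        { label = lab′ ; admissible = admissible′
        ; coarser = lab′-cong ∘ coarser
        ; glued = glued′
        ; connected = λ {x} {y} → connect x y
        }
        where
        open Stage stage renaming (glued to glued-before)
        open Erase (Alive (toℕ j)) (Alive (suc (toℕ j))) (relabel label) admissible
                   (leftMid j) (rightMid j) (turn j) (kept j) (keep j)
        glued′ : ∀ i → toℕ i < suc (toℕ j) → lab′ (leftMid i) ≡ lab′ (rightMid i)
        glued′ i i≤j with ℕₚ.m<1+n⇒m<n∨m≡n i≤j
        ... | inj₁ i<j = lab′-cong (glued-before i i<j)
        ... | inj₂ i≡j with toℕ-injective i≡j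
        ...   | refl = glued
        connect : ∀ x y → lab′ x ≡ lab′ y → Star (CompEdge p q) (π x) (π y)
        connect x y eq with merge-reflects (label (leftMid j)) (label (rightMid j)) eq
        ... | inj₁ xy = connected xy
        ... | inj₂ (inj₁ (xf , yg)) = connected xf ◅◅ connected (sym yg)
        ... | inj₂ (inj₂ (xg , yf)) = connected xg ◅◅ connected (sym yf)

      run : Admissible Everything J → ∀ i → i ≤ l → Stage i
      run adm zero    _   = start adm
      run adm (suc i) i<l = subst (Stage ∘ suc) (Finₚ.toℕ-fromℕ< i<l)
        (advance (fromℕ< i<l) (subst Stage (sym (Finₚ.toℕ-fromℕ< i<l)) (run adm i (ℕₚ.<⇒≤ i<l))))

      φ : Pt k n → V
      φ (inj₁ i) = inj₁ (inj₁ i)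
      φ (inj₂ j) = inj₂ (inj₂ j)

      π-φ : ∀ x → π (φ x) ≡ embR x
      π-φ (inj₁ _) = refl
      π-φ (inj₂ _) = refl

      module Final (final : Stage l) where
        open Stage final

        -- A middle point has a copy in each diagram; by `glued` either choice gives the same label,
        -- so the labels descend to the three rows.
        label₃ : Pt3 k l n → ℕ
        label₃ (inj₁ i)        = label (inj₁ (inj₁ i))
        label₃ (inj₂ (inj₁ j)) = label (leftMid j)
        label₃ (inj₂ (inj₂ j)) = label (inj₂ (inj₂ j))

        label₃-P : ∀ a → label₃ (embP a) ≡ label (inj₁ a)
        label₃-P (inj₁ _) = refl
        label₃-P (inj₂ _) = refl

        label₃-Q : ∀ b → label₃ (embQ b) ≡ label (inj₂ b)
        label₃-Q (inj₁ j) = glued j (toℕ<n j)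
        label₃-Q (inj₂ _) = refl

        label₃-R : ∀ x → label₃ (embR x) ≡ label (φ x)
        label₃-R (inj₁ _) = refl
        label₃-R (inj₂ _) = refl

        label₃-edge : ∀ {u v} → CompEdge p q u v → label₃ u ≡ label₃ v
        label₃-edge (viaP a b eq) = trans (label₃-P a)
          (trans (coarser {inj₁ a} {inj₁ b} (cong (2 ℕ.*_) eq)) (sym (label₃-P b)))
        label₃-edge (viaQ a b eq) = trans (label₃-Q a)
          (trans (coarser {inj₂ a} {inj₂ b} (cong (λ m → suc (2 ℕ.* m)) eq)) (sym (label₃-Q b)))

        label₃-star : ∀ {u v} → Star (CompEdge p q) u v → label₃ u ≡ label₃ v
        label₃-star ε        = refl
        label₃-star (e ◅ es) = trans (label₃-edge e) (label₃-star es)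

        lab-to : ∀ {x y} → blk r x ≡ blk r y → label (φ x) ≡ label (φ y)
        lab-to {x} {y} eq = trans (sym (label₃-R x))
          (trans (label₃-star (proj₁ (proj₂ (proj₂ composition) x y) eq)) (label₃-R y))

        lab-from : ∀ {x y} → label (φ x) ≡ label (φ y) → blk r x ≡ blk r y
        lab-from {x} {y} eq = proj₂ (proj₂ (proj₂ composition) x y)
          (subst id (cong₂ (Star (CompEdge p q)) (π-φ x) (π-φ y)) (connected eq))

        before-φ : ∀ x y → before x y ≡ J.lt (φ x) (φ y)
        before-φ (inj₁ _) (inj₁ _) = refl
        before-φ (inj₁ _) (inj₂ _) = refl
        before-φ (inj₂ _) (inj₁ _) = refl
        before-φ (inj₂ _) (inj₂ _) = refl

        ncol-φ : ∀ x → ncol r x ≡ J.clr (φ x)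
        ncol-φ (inj₁ i) = proj₁ composition i
        ncol-φ (inj₂ j) = cong inv (proj₁ (proj₂ composition) j)

        ht-φ : ∀ x → ht r x ≡ J.alt (φ x) ℤ.+ 0ℤ
        ht-φ (inj₁ i) = trans (height-cong (proj₁ composition) i) (sym (ℤₚ.+-identityʳ _))
        ht-φ (inj₂ j) = trans (height-cong (proj₁ (proj₂ composition)) j)
          (sym (trans (ℤₚ.+-identityʳ _) (ℤₚ.+-identityˡ _)))

        onto : ∀ v → Alive l v → ∃[ x ] φ x ≡ v
        onto (inj₁ (inj₁ i)) _   = inj₁ i , refl
        onto (inj₁ (inj₂ j)) l≤j = contradiction (toℕ<n j) (ℕₚ.≤⇒≯ l≤j)
        onto (inj₂ (inj₁ j)) l≤j = contradiction (toℕ<n j) (ℕₚ.≤⇒≯ l≤j)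
        onto (inj₂ (inj₂ j)) _   = inj₂ j , refl

        φ-injective : ∀ {x y} → φ x ≡ φ y → x ≡ y
        φ-injective {inj₁ _} {inj₁ _} refl = refl
        φ-injective {inj₂ _} {inj₂ _} refl = refl

        alive : ∀ x → Alive l (φ x)
        alive (inj₁ _) = tt
        alive (inj₂ _) = tt

        embedding : Embedding Q laws κ (Alive l) (relabel label) (diagram r)
        embedding = record
          { φ = φ ; φ-∈ = alive ; φ-injective = φ-injective ; φ-onto = onto
          ; lab-to = lab-to ; lab-from = lab-from
          ; φ-links = λ {a} {b} {x} {y} _ _ _ → links-cong before J.lt φ before-φ a b x y
          ; φ-clr = λ x y → subst id (cong₂ (λ c c′ → PairOK Q c c′ _) (sym (ncol-φ x)) (sym (ncol-φ y)))
          ; shift = λ _ → 0ℤ ; shift-∈ = λ _ → s-0 ; φ-alt = ht-φ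
          }

        result : Admissible Everything (diagram r)
        result = Embedding.transport embedding admissible

      -- The identified rows have equal colours and enter with opposite signs.
      Σ∘ : Σp r ≡ Σp p ℤ.+ Σp q
      Σ∘ = begin
        Σp r
          ≡⟨ Σp-rows r ⟩
        total (lower r) ℤ.- total (upper r)
          ≡⟨ cong₂ ℤ._-_ (prefix-cong (proj₁ composition) k) (prefix-cong (proj₁ (proj₂ composition)) n) ⟩
        total (lower p) ℤ.- total (upper q)
          ≡⟨ regroup (total (lower p)) (total (lower q)) (total (upper q)) ⟩
        (total (lower p) ℤ.- total (lower q)) ℤ.+ (total (lower q) ℤ.- total (upper q))
          ≡⟨ cong (λ z → (total (lower p) ℤ.- z) ℤ.+ (total (lower q) ℤ.- total (upper q)))
                  (prefix-cong (sym ∘ composable) l) ⟩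
        (total (lower p) ℤ.- total (upper p)) ℤ.+ (total (lower q) ℤ.- total (upper q))
          ≡⟨ sym (cong₂ ℤ._+_ (Σp-rows p) (Σp-rows q)) ⟩
        Σp p ℤ.+ Σp q ∎
        where
        open ≡-Reasoning
        regroup : ∀ a b c → a ℤ.- c ≡ (a ℤ.- b) ℤ.+ (b ℤ.- c)
        regroup = solve-∀

    comp-admitted : Admitted Q laws κ p → Admitted Q laws κ q → Admitted Q laws κ r
    comp-admitted (admᵖ , sᵖ) (admᵠ , sᵠ) =
      Final.result (run (juxtapose-admissible Q laws κ (λ _ → true) 0ℤ admᵖ admᵠ) l ℕₚ.≤-refl) ,
      subst sS (sym Σ∘) (s-+ sᵖ sᵠ)

-- Translation of the constraints

module _ {k l : ℕ} (p : Part k l) where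

  members : Pt k l → List (Pt k l)
  members α = filter (λ γ → blk p γ ≟ blk p α) (allPts k l)

  card-members : ∀ α → card p (blockOf p α) ≡ length (members α)
  card-members α = go (allPts k l)
    where
    go : ∀ xs → foldr (λ γ acc → (if blockOf p α γ then 1 else 0) + acc) 0 xs ≡
                length (filter (λ γ → blk p γ ≟ blk p α) xs)
    go []       = refl
    go (γ ∷ xs) with blk p γ ≡ᵇ blk p α
    ... | true  = cong suc (go xs)
    ... | false = go xs

  σ-members : ∀ α → σ p (blockOf p α) ≡ foldr (λ γ acc → wt p γ ℤ.+ acc) 0ℤ (members α)
  σ-members α = go (allPts k l)
    where
    go : ∀ xs → foldr (λ γ acc → (if blockOf p α γ then wt p γ else 0ℤ) ℤ.+ acc) 0ℤ xs ≡
                foldr (λ γ acc → wt p γ ℤ.+ acc) 0ℤ (filter (λ γ → blk p γ ≟ blk p α) xs)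
    go []       = refl
    go (γ ∷ xs) with blk p γ ≡ᵇ blk p α
    ... | true  = cong (ℤ._+_ (wt p γ)) (go xs)
    ... | false = trans (ℤₚ.+-identityˡ _) (go xs)

  members-unique : ∀ α → Unique (members α)
  members-unique α = Uniqueₚ.filter⁺ _ (Uniqueₚ.++⁺
    (Uniqueₚ.map⁺ inj₁-injective (Uniqueₚ.allFin⁺ k)) (Uniqueₚ.map⁺ inj₂-injective (Uniqueₚ.allFin⁺ l))
    disjoint)
    where
    disjoint : ∀ {γ} → ¬ (γ ∈ map inj₁ (allFin k) × γ ∈ map inj₂ (allFin l))
    disjoint (lo , up) with ∈-map⁻ inj₁ lo | ∈-map⁻ inj₂ up
    ... | _ , _ , refl | _ , _ , ()

  ∈-members : ∀ {α γ} → blk p γ ≡ blk p α → γ ∈ members α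
  ∈-members {γ = γ} eq = ∈-filter⁺ _ (∈-allPts γ) eq
    where
    ∈-allPts : ∀ γ → γ ∈ allPts k l
    ∈-allPts (inj₁ i) = ∈-++⁺ˡ (∈-map⁺ inj₁ (∈-allFin i))
    ∈-allPts (inj₂ j) = ∈-++⁺ʳ (map inj₁ (allFin k)) (∈-map⁺ inj₂ (∈-allFin j))

  members-blk : ∀ {α γ} → γ ∈ members α → blk p γ ≡ blk p α
  members-blk γ∈ = proj₂ (∈-filter⁻ _ {xs = allPts k l} γ∈)

  search : ∀ {P : Pt k l → Set} → (∀ γ → Dec (P γ)) → Dec (∃ P)
  search P? with Finₚ.any? (P? ∘ inj₁) | Finₚ.any? (P? ∘ inj₂)
  ... | yes (i , Pi) | _            = yes (inj₁ i , Pi)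
  ... | no _         | yes (j , Pj) = yes (inj₂ j , Pj)
  ... | no ¬lo       | no ¬up       = no λ { (inj₁ i , Pi) → ¬lo (i , Pi) ; (inj₂ j , Pj) → ¬up (j , Pj) }

  inOpen-between : ∀ {α β γ} → pos p α < pos p β → inOpen p α β γ ≡ true →
                   pos p α < pos p γ × pos p γ < pos p β
  inOpen-between {α} {β} {γ} a<b eq rewrite <ᵇ-true a<b with pos p α <? pos p γ | pos p γ <? pos p β
  ... | yes a<c | yes c<b = a<c , c<b
  ... | yes a<c | no c≮b rewrite <ᵇ-true a<c | <ᵇ-false (ℕₚ.≮⇒≥ c≮b) = contradiction eq λ ()
  ... | no a≮c  | _      rewrite <ᵇ-false (ℕₚ.≮⇒≥ a≮c) = contradiction eq λ ()

  -- Membership in the interval from α to β and in the one from β to α differ in their orientation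
  -- term only. Adding the two memberships turns this term into a constant and leaves the parity of
  -- the four comparisons.
  crossing⇒links : ∀ {α β α′ β′} → α ≢ β → α ≢ α′ → β ≢ α′ → α ≢ β′ → β ≢ β′ →
                   inOpen p α β α′ ≡ true → inOpen p β α β′ ≡ true → links before α β α′ β′ ≡ true
  crossing⇒links {α} {β} {α′} {β′} α≢β αα′ βα′ αβ′ ββ′ in₁ in₂ =
    bits (before α α′ xor before β α′) (before α β′ xor before β β′) (before α β)
      (trans (sym (inOpen-xor p αα′ βα′ α≢β)) in₁)
      (trans (cong₂ (λ u t → u xor not t) (xor-comm (before α β′) (before β β′)) (sym (before-swap (α≢β ∘ sym))))
        (trans (sym (inOpen-xor p ββ′ αβ′ (α≢β ∘ sym))) in₂))
    where
    bits : ∀ u v t → u xor not t ≡ true → v xor not (not t) ≡ true → u xor v ≡ true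
    bits true  false _     _  _  = refl
    bits false true  _     _  _  = refl
    bits true  true  true  _  ()
    bits true  true  false () _
    bits false false true  () _
    bits false false false _  ()

  -- Odd parity means that `x` and `y` lie on different sides of the chord: one in the interval from
  -- `a` to `b`, the other in the interval from `b` to `a`.
  links⇒crossing : ∀ {a b x y} → blk p a ≡ blk p b → blk p x ≡ blk p y → blk p a ≢ blk p x →
                   links before a b x y ≡ true → Crossing p a x
  links⇒crossing {a} {b} {x} {y} ab xy a≁x lk with
    bits (before a x xor before b x) (before a y xor before b y) (before a b) lk
    where
    bits : ∀ u v t → u xor v ≡ true →
      (u xor not t ≡ true × v xor not (not t) ≡ true) ⊎ (v xor not t ≡ true × u xor not (not t) ≡ true)
    bits true  false true  _ = inj₁ (refl , refl)
    bits true  false false _ = inj₂ (refl , refl)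
    bits false true  true  _ = inj₂ (refl , refl)
    bits false true  false _ = inj₁ (refl , refl)
    bits true  true  _     ()
    bits false false _     ()
  ... | choice = a≁x , a , b , cross choice
    where
    a≢b : a ≢ b
    a≢b refl = contradiction
      (trans (sym lk) (cong₂ _xor_ (xor-same (before a x)) (xor-same (before a y)))) λ ()
    x≢y : x ≢ y
    x≢y refl = contradiction (trans (sym lk) (xor-same (before a x xor before b x))) λ ()
    inᵃᵇ : ∀ {z} → blk p z ≡ blk p x → (before a z xor before b z) xor not (before a b) ≡ true →
           inOpen p a b z ≡ true
    inᵃᵇ zx = trans (inOpen-xor p (λ { refl → a≁x zx }) (λ { refl → a≁x (trans ab zx) }) a≢b)
    inᵇᵃ : ∀ {z} → blk p z ≡ blk p x → (before a z xor before b z) xor not (not (before a b)) ≡ true →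
           inOpen p b a z ≡ true
    inᵇᵃ {z} zx eq = trans
      (inOpen-xor p (λ { refl → a≁x (trans ab zx) }) (λ { refl → a≁x zx }) (a≢b ∘ sym))
      (trans (cong₂ (λ u t → u xor not t) (xor-comm (before b z) (before a z)) (before-swap (a≢b ∘ sym))) eq)
    u v t : Bool
    u = before a x xor before b x
    v = before a y xor before b y
    t = before a b
    cross : (u xor not t ≡ true × v xor not (not t) ≡ true) ⊎ (v xor not t ≡ true × u xor not (not t) ≡ true) →
            ∃[ α′ ] ∃[ β′ ] (blk p a ≡ blk p a × blk p b ≡ blk p a × a ≢ b ×
              blk p α′ ≡ blk p x × blk p β′ ≡ blk p x × α′ ≢ β′ ×
              inOpen p a b α′ ≡ true × inOpen p b a β′ ≡ true)
    cross (inj₁ (in-x , in-y)) = x , y , refl , sym ab , a≢b , refl , sym xy , x≢y ,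
      inᵃᵇ refl in-x , inᵇᵃ (sym xy) in-y
    cross (inj₂ (in-y , in-x)) = y , x , refl , sym ab , a≢b , sym xy , refl , x≢y ∘ sym ,
      inᵃᵇ (sym xy) in-y , inᵇᵃ refl in-x

module _ (Q : Tuple) where
  open Tuple Q

  -- What `f`, `v`, `l` and `k` provide for each block size. The values 2 and -2 are asked of `v`
  -- only if `l` is inhabited, since they stem from two points of equal normalized colour. For
  -- arbitrary blocks `l` and `k` agree, so that consecutive differences can be added whatever the
  -- colours.
  data SizeLaws : Size → Set where
    exactlyTwo : (∀ {n} → fS n → n ≡ 2) → fS 2 →
                 vS 0ℤ → (∀ {z} → lS z → vS (+ 2) × vS (- + 2)) → SizeLaws exactlyTwo
    atMostTwo  : (∀ {n} → fS n → n ≡ 1 ⊎ n ≡ 2) → fS 1 → fS 2 →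
                 vS 0ℤ → vS 1ℤ → vS -1ℤ → (∀ {z} → lS z → vS (+ 2) × vS (- + 2)) → SizeLaws atMostTwo
    arbitrary  : (∀ {n} → 1 ≤ n → fS n) → (∀ z → vS z) →
                 (∀ {z} → lS z → kS z) → (∀ {z} → kS z → lS z) → SizeLaws arbitrary

  module _ (laws : Laws Q) (κ : Size) (sizeLaws : SizeLaws κ) {k l : ℕ} (p : Part k l) where
    open Laws laws
    open Theory Q laws κ

    offset-∈ : sS (Σp p) → ∀ α β → sS (offset p α β)
    offset-∈ sΣ α β = s-+ (s-+ (base-∈ β) (s-neg (base-∈ α))) wrap-∈
      where
      base-∈ : ∀ α → sS (base p α)
      base-∈ (inj₁ _) = s-0
      base-∈ (inj₂ _) = sΣ
      wrap-∈ : sS (wrap p α β)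
      wrap-∈ with wrap-multiple p α β
      ... | inj₁ eq = subst sS (sym eq) s-0
      ... | inj₂ eq = subst sS (sym eq) sΣ

    δ⇒ht : (P : ℤ → Set) → (∀ {a s} → P a → sS s → P (a ℤ.+ s)) → sS (Σp p) →
           ∀ {α β} → α ≢ β → P (δ p α β) → P (ht p β ℤ.- ht p α)
    δ⇒ht P shift sΣ {α} {β} α≢β Pδ = subst P
      (trans (cong (ℤ._+ - offset p α β) (δ-ht p α≢β)) (cancel _ (offset p α β)))
      (shift Pδ (s-neg (offset-∈ sΣ α β)))
      where
      cancel : ∀ d o → (d ℤ.+ o) ℤ.+ - o ≡ d
      cancel = solve-∀

    ht⇒δ : (P : ℤ → Set) → (∀ {a s} → P a → sS s → P (a ℤ.+ s)) → sS (Σp p) →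
           ∀ {α β} → α ≢ β → P (ht p β ℤ.- ht p α) → P (δ p α β)
    ht⇒δ P shift sΣ {α} {β} α≢β Ph = subst P (sym (δ-ht p α≢β)) (shift Ph (offset-∈ sΣ α β))

    three-in-two : ∀ {xs : List (Pt k l)} {x y z} → length xs ≡ 1 ⊎ length xs ≡ 2 →
                   x ∈ xs → y ∈ xs → z ∈ xs → x ≡ y ⊎ x ≡ z ⊎ y ≡ z
    three-in-two {[]} (inj₁ ())
    three-in-two {[]} (inj₂ ())
    three-in-two {_ ∷ _ ∷ _ ∷ _} (inj₁ ())
    three-in-two {_ ∷ _ ∷ _ ∷ _} (inj₂ ())
    three-in-two {_ ∷ []} _ (here refl) (here refl) _ = inj₁ refl
    three-in-two {_ ∷ _ ∷ []} _ (here refl) (here refl) _ = inj₁ refl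
    three-in-two {_ ∷ _ ∷ []} _ (there (here refl)) (there (here refl)) _ = inj₁ refl
    three-in-two {_ ∷ _ ∷ []} _ (here refl) (there (here refl)) (here refl) = inj₂ (inj₁ refl)
    three-in-two {_ ∷ _ ∷ []} _ (here refl) (there (here refl)) (there (here refl)) = inj₂ (inj₂ refl)
    three-in-two {_ ∷ _ ∷ []} _ (there (here refl)) (here refl) (here refl) = inj₂ (inj₂ refl)
    three-in-two {_ ∷ _ ∷ []} _ (there (here refl)) (here refl) (there (here refl)) = inj₂ (inj₁ refl)

    other-in-two : ∀ {xs : List (Pt k l)} {x} → length xs ≡ 2 → Unique xs → x ∈ xs →
                   ∃[ y ] (y ∈ xs × y ≢ x)
    other-in-two {[]} ()
    other-in-two {_ ∷ []} ()
    other-in-two {_ ∷ _ ∷ _ ∷ _} ()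
    other-in-two {a ∷ b ∷ []} _ ((a≢b All.∷ _) ∷ _) (here refl)         = b , there (here refl) , a≢b ∘ sym
    other-in-two {a ∷ b ∷ []} _ ((a≢b All.∷ _) ∷ _) (there (here refl)) = a , here refl , a≢b

    size⇒bounded : FSub p fS → Bounded κ → ∀ {x y z} → blk p x ≡ blk p y → blk p x ≡ blk p z →
                   x ≡ y ⊎ x ≡ z ⊎ y ≡ z
    size⇒bounded F b {x} xy xz = three-in-two (sizes sizeLaws b (subst fS (card-members p x) (F x)))
      (∈-members p refl) (∈-members p (sym xy)) (∈-members p (sym xz))
      where
      sizes : ∀ {κ} → SizeLaws κ → Bounded κ → ∀ {n} → fS n → n ≡ 1 ⊎ n ≡ 2
      sizes (exactlyTwo two _ _ _) _ = inj₂ ∘ two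
      sizes (atMostTwo one-two _ _ _ _ _ _) _ = one-two
      sizes (arbitrary _ _ _ _) ()

    size⇒partner : FSub p fS → Paired κ → ∀ x → ∃[ y ] (y ≢ x × blk p y ≡ blk p x)
    size⇒partner F pr x with other-in-two (sizes sizeLaws pr (subst fS (card-members p x) (F x)))
                               (members-unique p x) (∈-members p {x} refl)
      where
      sizes : ∀ {κ} → SizeLaws κ → Paired κ → ∀ {n} → fS n → n ≡ 2
      sizes (exactlyTwo two _ _ _) _ = two
      sizes (atMostTwo _ _ _ _ _ _ _) ()
      sizes (arbitrary _ _ _ _) ()
    ... | y , y∈ , y≢x = y , y≢x , members-blk p y∈

    overfull : (∀ {x y z} → blk p x ≡ blk p y → blk p x ≡ blk p z → x ≡ y ⊎ x ≡ z ⊎ y ≡ z) →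
               ∀ {α x y z xs} → Unique (x ∷ y ∷ z ∷ xs) →
               (∀ {γ} → γ ∈ x ∷ y ∷ z ∷ xs → blk p γ ≡ blk p α) → ⊥
    overfull bounded ((x≢y All.∷ x≢z All.∷ _) ∷ (y≢z All.∷ _) ∷ _) same
      with bounded (trans (same (here refl)) (sym (same (there (here refl)))))
                   (trans (same (here refl)) (sym (same (there (there (here refl))))))
    ... | inj₁ x≡y        = x≢y x≡y
    ... | inj₂ (inj₁ x≡z) = x≢z x≡z
    ... | inj₂ (inj₂ y≡z) = y≢z y≡z

    consecutive-pairOK : LSub p lS → KSub p kS → ∀ {α β} → Consecutive p α β →
                         PairOK Q (ncol p α) (ncol p β) (δ p α β)
    consecutive-pairOK L K {α} {β} cons = go (ncol p α) (ncol p β) refl refl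
      where
      wts : ∀ {c c′} → ncol p α ≡ c → ncol p β ≡ c′ → wt p α ℤ.+ wt p β ≡ weight c ℤ.+ weight c′
      wts eq eq′ = cong₂ ℤ._+_ (trans (wt-weight p α) (cong weight eq)) (trans (wt-weight p β) (cong weight eq′))
      go : ∀ c c′ → ncol p α ≡ c → ncol p β ≡ c′ → PairOK Q c c′ (δ p α β)
      go white white eq eq′ = L α β cons (λ z → contradiction (trans (sym (wts eq eq′)) z) λ ())
      go white black eq eq′ = K α β cons (wts eq eq′)
      go black white eq eq′ = K α β cons (wts eq eq′)
      go black black eq eq′ = L α β cons (λ z → contradiction (trans (sym (wts eq eq′)) z) λ ())

    pairOK⇒L : ∀ α β {z} → PairOK Q (ncol p α) (ncol p β) z → ¬ wt p α ℤ.+ wt p β ≡ 0ℤ → lS z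
    pairOK⇒L α β rewrite wt-weight p α | wt-weight p β = go (ncol p α) (ncol p β)
      where
      go : ∀ c c′ {z} → PairOK Q c c′ z → ¬ weight c ℤ.+ weight c′ ≡ 0ℤ → lS z
      go white white lz _  = lz
      go white black _  ≢0 = contradiction refl ≢0
      go black white _  ≢0 = contradiction refl ≢0
      go black black lz _  = lz

    pairOK⇒K : ∀ α β {z} → PairOK Q (ncol p α) (ncol p β) z → wt p α ℤ.+ wt p β ≡ 0ℤ → kS z
    pairOK⇒K α β rewrite wt-weight p α | wt-weight p β = go (ncol p α) (ncol p β)
      where
      go : ∀ c c′ {z} → PairOK Q c c′ z → weight c ℤ.+ weight c′ ≡ 0ℤ → kS z
      go white black kz _ = kz
      go black white kz _ = kz

    -- In a large block the differences of heights telescope along its consecutive points.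
    chain : (∀ {z} → lS z → kS z) → LSub p lS → KSub p kS → sS (Σp p) →
            ∀ n {α β} → pos p α < pos p β → pos p β ≤ pos p α + n → blk p α ≡ blk p β →
            kS (ht p β ℤ.- ht p α)
    chain l⇒k L K sΣ zero {α} a<b b≤a _ =
      contradiction (ℕₚ.≤-trans b≤a (ℕₚ.≤-reflexive (ℕₚ.+-identityʳ _))) (ℕₚ.<⇒≱ a<b)
    chain l⇒k L K sΣ (suc n) {α} {β} a<b b≤a+n αβ
      with search p (λ γ → (inOpen p α β γ Boolₚ.≟ true) ×-dec (blk p γ ≟ blk p α))
    ... | yes (γ , in-αβ , γα) = subst kS (telescope (ht p α) (ht p β) (ht p γ))
          (k+k (chain l⇒k L K sΣ n a<c c≤a+n (sym γα)) (chain l⇒k L K sΣ n c<b b≤c+n (trans γα αβ)))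
      where
      a<c : pos p α < pos p γ
      a<c = proj₁ (inOpen-between p {α} {β} {γ} a<b in-αβ)
      c<b : pos p γ < pos p β
      c<b = proj₂ (inOpen-between p {α} {β} {γ} a<b in-αβ)
      b≤1+a+n : pos p β ≤ suc (pos p α + n)
      b≤1+a+n = ℕₚ.≤-trans b≤a+n (ℕₚ.≤-reflexive (ℕₚ.+-suc _ n))
      c≤a+n : pos p γ ≤ pos p α + n
      c≤a+n = ℕ.s≤s⁻¹ (ℕₚ.≤-trans c<b b≤1+a+n)
      b≤c+n : pos p β ≤ pos p γ + n
      b≤c+n = ℕₚ.≤-trans b≤1+a+n (ℕₚ.+-monoˡ-≤ n a<c)
      telescope : ∀ a b c → (c ℤ.- a) ℤ.+ (b ℤ.- c) ≡ b ℤ.- a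
      telescope = solve-∀
    ... | no none = δ⇒ht kS (λ ka s → k+k ka (s⇒k s)) sΣ α≢β
          (toK (ncol p α) (ncol p β) (consecutive-pairOK L K (αβ , α≢β , λ γ in-αβ γα → none (γ , in-αβ , γα))))
      where
      α≢β : α ≢ β
      α≢β refl = ℕₚ.<-irrefl refl a<b
      toK : ∀ c c′ {z} → PairOK Q c c′ z → kS z
      toK white white = l⇒k
      toK white black = id
      toK black white = id
      toK black black = l⇒k

    R⇒admitted : R Q p → Admitted Q laws κ p
    R⇒admitted (F , V , sΣ , L , K , X) = record
      { bounded = λ b _ _ _ → size⇒bounded F b
      ; partner = λ pr {x} _ → let y , y≢x , yx = size⇒partner F pr x in y , tt , y≢x , yx
      ; pairs   = λ _ _ → pairs sizeLaws (size⇒bounded F)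
      ; crossed = λ {a} {b} {x} {y} _ _ _ _ ab xy a≁x lk →
          δ⇒ht xS x-shift sΣ (a≁x ∘ cong (blk p)) (X a x (links⇒crossing p ab xy a≁x lk))
      } , sΣ
      where
      -- In a block of at most two points, distinct points are consecutive: a block point inside the
      -- interval would be a third one.
      pairs-bounded : (∀ {x y z} → blk p x ≡ blk p y → blk p x ≡ blk p z → x ≡ y ⊎ x ≡ z ⊎ y ≡ z) →
                      ∀ {x y} → x ≢ y → blk p x ≡ blk p y → PairOK Q (ncol p x) (ncol p y) (ht p y ℤ.- ht p x)
      pairs-bounded bounded {x} {y} x≢y xy =
        δ⇒ht (PairOK Q (ncol p x) (ncol p y)) (PairOK-shift (ncol p x) (ncol p y)) sΣ x≢y
          (consecutive-pairOK L K (xy , x≢y , alone))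
        where
        alone : ∀ γ → inOpen p x y γ ≡ true → blk p γ ≢ blk p x
        alone γ in-xy γx with inOpen-distinct p x≢y in-xy | bounded xy (sym γx)
        ... | γ≢x , γ≢y | inj₁ x≡y        = x≢y x≡y
        ... | γ≢x , γ≢y | inj₂ (inj₁ x≡γ) = γ≢x (sym x≡γ)
        ... | γ≢x , γ≢y | inj₂ (inj₂ y≡γ) = γ≢y (sym y≡γ)
      pairs-arbitrary : (∀ {z} → lS z → kS z) → (∀ {z} → kS z → lS z) →
                        ∀ {x y} → x ≢ y → blk p x ≡ blk p y → PairOK Q (ncol p x) (ncol p y) (ht p y ℤ.- ht p x)
      pairs-arbitrary l⇒k k⇒l {x} {y} x≢y xy = fromK (ncol p x) (ncol p y) difference
        where
        fromK : ∀ c c′ {z} → kS z → PairOK Q c c′ z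
        fromK white white = k⇒l
        fromK white black = id
        fromK black white = id
        fromK black black = k⇒l
        flip : ∀ a b → - (a ℤ.- b) ≡ b ℤ.- a
        flip = solve-∀
        difference : kS (ht p y ℤ.- ht p x)
        difference with <-cmp (pos p x) (pos p y)
        -- `chain` climbs along increasing positions, and the larger position bounds the gap. For
        -- the opposite order the difference is negated, so no chain passes the start of the lower
        -- row.
        ... | tri< x<y _ _ = chain l⇒k L K sΣ (pos p y) x<y (ℕₚ.m≤n+m _ _) xy
        ... | tri≈ _ x≡y _ = contradiction (pos-injective p x≡y) x≢y
        ... | tri> _ _ y<x = subst kS (flip (ht p x) (ht p y))
              (k-neg (chain l⇒k L K sΣ (pos p x) y<x (ℕₚ.m≤n+m _ _) (sym xy)))
      pairs : ∀ {κ} → SizeLaws κ →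
              (Bounded κ → ∀ {x y z} → blk p x ≡ blk p y → blk p x ≡ blk p z → x ≡ y ⊎ x ≡ z ⊎ y ≡ z) →
              ∀ {x y} → x ≢ y → blk p x ≡ blk p y → PairOK Q (ncol p x) (ncol p y) (ht p y ℤ.- ht p x)
      pairs (exactlyTwo _ _ _ _)        bounded = pairs-bounded (bounded tt)
      pairs (atMostTwo _ _ _ _ _ _ _)   bounded = pairs-bounded (bounded tt)
      pairs (arbitrary _ _ l⇒k k⇒l)     _       = pairs-arbitrary l⇒k k⇒l

    module _ (admitted : Admitted Q laws κ p) where
      open Admissible (proj₁ admitted)

      -- Two points of equal colour exhibit, through `pairs`, an element of `lS`; this is what
      -- supplies the values 2 and -2.
      pair-v : vS 0ℤ → (∀ {z} → lS z → vS (+ 2) × vS (- + 2)) → ∀ {α β} → α ≢ β → blk p α ≡ blk p β →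
               vS (wt p α ℤ.+ (wt p β ℤ.+ 0ℤ))
      pair-v v0 v2 {α} {β} α≢β αβ rewrite wt-weight p α | wt-weight p β =
        go (ncol p α) (ncol p β) (pairs tt tt α≢β αβ)
        where
        go : ∀ c c′ {z} → PairOK Q c c′ z → vS (weight c ℤ.+ (weight c′ ℤ.+ 0ℤ))
        go white white lz = proj₁ (v2 lz)
        go white black _  = v0
        go black white _  = v0
        go black black lz = proj₂ (v2 lz)

      sizes : ∀ α → fS (length (members p α)) × vS (foldr (λ γ acc → wt p γ ℤ.+ acc) 0ℤ (members p α))
      sizes α = go sizeLaws bounded partner (members p α) (members-unique p α) (∈-members p refl)
                  (members-blk p) (∈-members p)
        where
        go : ∀ {κ} → SizeLaws κ →
          (Bounded κ → ∀ {x y z} → ⊤ → ⊤ → ⊤ → blk p x ≡ blk p y → blk p x ≡ blk p z → x ≡ y ⊎ x ≡ z ⊎ y ≡ z) →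
          (Paired κ → ∀ {x} → ⊤ → ∃[ y ] (⊤ × y ≢ x × blk p y ≡ blk p x)) →
          ∀ xs → Unique xs → α ∈ xs → (∀ {γ} → γ ∈ xs → blk p γ ≡ blk p α) →
          (∀ {γ} → blk p γ ≡ blk p α → γ ∈ xs) →
          fS (length xs) × vS (foldr (λ γ acc → wt p γ ℤ.+ acc) 0ℤ xs)
        go _ _ _ [] _ () _ _
        go (arbitrary f v _ _) _ _ (_ ∷ _) _ _ _ _ = f (s≤s z≤n) , v _
        go (exactlyTwo _ _ _ _) _ partner (x ∷ []) _ _ same all with partner tt {x} tt
        ... | y , _ , y≢x , yx with all (trans yx (same (here refl)))
        ...   | here y≡x = contradiction y≡x y≢x
        go (atMostTwo _ f1 _ _ v1 v-1 _) _ _ (x ∷ []) _ _ _ _ rewrite wt-weight p x = f1 , single (ncol p x)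
          where
          single : ∀ c → vS (weight c ℤ.+ 0ℤ)
          single white = v1
          single black = v-1
        go (exactlyTwo _ f2 v0 v2) _ _ (x ∷ y ∷ []) ((x≢y All.∷ _) ∷ _) _ same _ =
          f2 , pair-v v0 v2 x≢y (trans (same (here refl)) (sym (same (there (here refl)))))
        go (atMostTwo _ _ f2 v0 _ _ v2) _ _ (x ∷ y ∷ []) ((x≢y All.∷ _) ∷ _) _ same _ =
          f2 , pair-v v0 v2 x≢y (trans (same (here refl)) (sym (same (there (here refl)))))
        go (exactlyTwo _ _ _ _) bounded _ (x ∷ y ∷ z ∷ _) unique _ same _ =
          ⊥-elim (overfull (bounded tt tt tt tt) unique same)
        go (atMostTwo _ _ _ _ _ _ _) bounded _ (x ∷ y ∷ z ∷ _) unique _ same _ =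
          ⊥-elim (overfull (bounded tt tt tt tt) unique same)

      -- `X` concerns all points of two crossing blocks, whereas `crossed` speaks of ends of
      -- crossing chords. The difference of heights is carried from those ends to any other point of
      -- the block.
      blocks-joined : ∀ {α β} → blk p α ≡ blk p β → ∀ {z} → xS z →
                      xS (z ℤ.+ (ht p β ℤ.- ht p α))
      blocks-joined {α} {β} αβ {z} xz with pos p α ≟ pos p β
      ... | no α≢β = x-PairOK (ncol p α) (ncol p β) xz (pairs tt tt (α≢β ∘ cong (pos p)) αβ)
      ... | yes eq with pos-injective p {α} {β} eq
      ...   | refl = subst xS (pad z (ht p α)) xz
        where
        pad : ∀ z h → z ≡ z ℤ.+ (h ℤ.- h)
        pad = solve-∀

      admitted⇒X : XSub p xS
      admitted⇒X α₁ α₂ (α₁≁α₂ , α , β , α′ , β′ , α₁α , α₁β , α≢β , α₂α′ , α₂β′ , _ , in₁ , in₂) =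
        ht⇒δ xS x-shift (proj₂ admitted) (α₁≁α₂ ∘ cong (blk p))
          (subst xS (telescope (ht p α₁) (ht p α₂) (ht p α) (ht p α′))
            (blocks-joined {α′} {α₂} α₂α′ (blocks-joined {α₁} {α} (sym α₁α)
              (crossed {α} {β} {α′} {β′} tt tt tt tt (trans α₁α (sym α₁β)) (trans α₂α′ (sym α₂β′))
                (apart α₁α α₂α′)
                (crossing⇒links p α≢β (apart α₁α α₂α′ ∘ cong (blk p)) (apart α₁β α₂α′ ∘ cong (blk p))
                  (apart α₁α α₂β′ ∘ cong (blk p)) (apart α₁β α₂β′ ∘ cong (blk p)) in₁ in₂)))))
        where
        apart : ∀ {γ γ′} → blk p γ ≡ blk p α₁ → blk p γ′ ≡ blk p α₂ → blk p γ ≢ blk p γ′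
        apart γα₁ γ′α₂ γγ′ = α₁≁α₂ (trans (sym γα₁) (trans γγ′ γ′α₂))
        telescope : ∀ a₁ a₂ a a′ → ((a′ ℤ.- a) ℤ.+ (a ℤ.- a₁)) ℤ.+ (a₂ ℤ.- a′) ≡ a₂ ℤ.- a₁
        telescope = solve-∀

      consecutive-δ : ∀ {α β} → Consecutive p α β → PairOK Q (ncol p α) (ncol p β) (δ p α β)
      consecutive-δ {α} {β} (αβ , α≢β , _) =
        ht⇒δ (PairOK Q (ncol p α) (ncol p β)) (PairOK-shift (ncol p α) (ncol p β)) (proj₂ admitted)
          α≢β (pairs tt tt α≢β αβ)

      admitted⇒R : R Q p
      admitted⇒R =
        (λ α → subst fS (sym (card-members p α)) (proj₁ (sizes α))) ,
        (λ α → subst vS (sym (σ-members p α)) (proj₂ (sizes α))) ,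
        proj₂ admitted ,
        (λ α β cons → pairOK⇒L α β (consecutive-δ cons)) ,
        (λ α β cons → pairOK⇒K α β (consecutive-δ cons)) ,
        admitted⇒X

-- The generating partitions and the two singletons

module _ (Q : Tuple) (laws : Laws Q) (κ : Size) where
  open Tuple Q
  open Laws laws
  open Theory Q laws κ

  Bool-pigeonhole : ∀ {V : Set} (t : V → Bool) → (∀ {x y} → t x ≡ t y → x ≡ y) →
                    ∀ x y z → x ≡ y ⊎ x ≡ z ⊎ y ≡ z
  Bool-pigeonhole t t-injective x y z with t x in tx | t y in ty | t z in tz
  ... | true  | true  | _     = inj₁ (t-injective (trans tx (sym ty)))
  ... | false | false | _     = inj₁ (t-injective (trans tx (sym ty)))
  ... | true  | false | true  = inj₂ (inj₁ (t-injective (trans tx (sym tz))))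
  ... | false | true  | false = inj₂ (inj₁ (t-injective (trans tx (sym tz))))
  ... | true  | false | false = inj₂ (inj₂ (t-injective (trans ty (sym tz))))
  ... | false | true  | true  = inj₂ (inj₂ (t-injective (trans ty (sym tz))))

  -- The injection `t` into the Booleans leaves at most two points, and a single block crosses
  -- nothing.
  pairing-admitted : ∀ {k l} (p : Part k l) (t : Pt k l → Bool) → (∀ {x y} → t x ≡ t y → x ≡ y) →
    (∀ x → ∃[ y ] y ≢ x) → (∀ x y → blk p x ≡ blk p y) →
    (∀ x y → x ≢ y → PairOK Q (ncol p x) (ncol p y) (ht p y ℤ.- ht p x)) →
    Σp p ≡ 0ℤ → Admitted Q laws κ p
  pairing-admitted p t t-injective other one-block pairOK neutral = record
    { bounded = λ _ {x} {y} {z} _ _ _ _ _ → Bool-pigeonhole t t-injective x y z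
    ; partner = λ _ {x} _ → let y , y≢x = other x in y , tt , y≢x , one-block y x
    ; pairs   = λ {x} {y} _ _ x≢y _ → pairOK x y x≢y
    ; crossed = λ {a} {b} {x} _ _ _ _ _ _ a≁x _ → contradiction (one-block a x) a≁x
    } , subst sS (sym neutral) s-0

  k-0 : kS 0ℤ
  k-0 = s⇒k s-0

  empty-admitted : Admitted Q laws κ emptyP
  empty-admitted = record
    { bounded = λ { _ {inj₁ ()} ; _ {inj₂ ()} }
    ; partner = λ { _ {inj₁ ()} ; _ {inj₂ ()} }
    ; pairs   = λ { {inj₁ ()} ; {inj₂ ()} }
    ; crossed = λ { {inj₁ ()} ; {inj₂ ()} }
    } , s-0

  idP-admitted : ∀ c → Admitted Q laws κ (idP c)
  idP-admitted c = pairing-admitted (idP c) isLower injective other (λ _ _ → refl) (pairOK c) (neutral c)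
    where
    injective : ∀ {x y : Pt 1 1} → isLower x ≡ isLower y → x ≡ y
    injective {inj₁ zero} {inj₁ zero} _ = refl
    injective {inj₂ zero} {inj₂ zero} _ = refl
    other : ∀ (x : Pt 1 1) → ∃[ y ] y ≢ x
    other (inj₁ _) = inj₂ zero , λ ()
    other (inj₂ _) = inj₁ zero , λ ()
    pairOK : ∀ c x y → x ≢ y →
             PairOK Q (ncol (idP c) x) (ncol (idP c) y) (ht (idP c) y ℤ.- ht (idP c) x)
    pairOK c     (inj₁ zero) (inj₁ zero) x≢x = contradiction refl x≢x
    pairOK c     (inj₂ zero) (inj₂ zero) x≢x = contradiction refl x≢x
    pairOK white (inj₁ zero) (inj₂ zero) _ = k-0
    pairOK black (inj₁ zero) (inj₂ zero) _ = k-0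
    pairOK white (inj₂ zero) (inj₁ zero) _ = k-0
    pairOK black (inj₂ zero) (inj₁ zero) _ = k-0
    neutral : ∀ c → Σp (idP c) ≡ 0ℤ
    neutral white = refl
    neutral black = refl

  pairP-admitted : ∀ c → Admitted Q laws κ (pairP c (inv c))
  pairP-admitted c = pairing-admitted (pairP c (inv c)) first injective other (λ _ _ → refl) (pairOK c) (neutral c)
    where
    first : Pt 2 0 → Bool
    first (inj₁ zero)    = true
    first (inj₁ (suc _)) = false
    injective : ∀ {x y} → first x ≡ first y → x ≡ y
    injective {inj₁ zero}       {inj₁ zero}       _ = refl
    injective {inj₁ (suc zero)} {inj₁ (suc zero)} _ = refl
    other : ∀ (x : Pt 2 0) → ∃[ y ] y ≢ x
    other (inj₁ zero)    = inj₁ (suc zero) , λ ()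
    other (inj₁ (suc _)) = inj₁ zero , λ ()
    pairOK : ∀ c x y → x ≢ y → PairOK Q (ncol (pairP c (inv c)) x) (ncol (pairP c (inv c)) y)
             (ht (pairP c (inv c)) y ℤ.- ht (pairP c (inv c)) x)
    pairOK c     (inj₁ zero)       (inj₁ zero)       x≢x = contradiction refl x≢x
    pairOK c     (inj₁ (suc zero)) (inj₁ (suc zero)) x≢x = contradiction refl x≢x
    pairOK white (inj₁ zero)       (inj₁ (suc zero)) _ = k-0
    pairOK black (inj₁ zero)       (inj₁ (suc zero)) _ = k-0
    pairOK white (inj₁ (suc zero)) (inj₁ zero)       _ = k-0
    pairOK black (inj₁ (suc zero)) (inj₁ zero)       _ = k-0
    neutral : ∀ c → Σp (pairP c (inv c)) ≡ 0ℤ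
    neutral white = refl
    neutral black = refl

  -- No label occurs twice, so the conditions on pairs and on crossings are vacuous; only blocks of
  -- size exactly two would exclude it.
  singP-admitted : ¬ Paired κ → Admitted Q laws κ singP
  singP-admitted unpaired = record
    { bounded = λ { _ {x} {y} _ _ _ xy _ → inj₁ (blk-injective x y xy) }
    ; partner = λ pr → contradiction pr unpaired
    ; pairs   = λ { {x} {y} _ _ x≢y xy → contradiction (blk-injective x y xy) x≢y }
    ; crossed = λ { {a} {b} {x} {y} _ _ _ _ ab xy _ lk →
        contradiction lk (unlinked (blk-injective a b ab) (blk-injective x y xy)) }
    } , s-0
    where
    blk-injective : ∀ x y → blk singP x ≡ blk singP y → x ≡ y
    blk-injective (inj₁ zero)       (inj₁ zero)       _ = refl
    blk-injective (inj₁ (suc zero)) (inj₁ (suc zero)) _ = refl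
    unlinked : ∀ {a b x y : Pt 2 0} → a ≡ b → x ≡ y → links before a b x y ≢ true
    unlinked {a} {x = x} refl refl rewrite xor-same (before a x) = λ ()

-- The category attached to a tuple satisfying the laws

module _ {Q : Tuple} (laws : Laws Q) {κ : Size} (sizeLaws : SizeLaws Q κ) where

  admit : ∀ {k l} (p : Part k l) → R Q p → Admitted Q laws κ p
  admit = R⇒admitted Q laws κ sizeLaws

  release : ∀ {k l} (p : Part k l) → Admitted Q laws κ p → R Q p
  release = admitted⇒R Q laws κ sizeLaws

  isCategory : IsCategory (R Q)
  isCategory = record
    { hasEmpty     = release emptyP (empty-admitted Q laws κ)
    ; hasIdW       = release (idP white) (idP-admitted Q laws κ white)
    ; hasIdB       = release (idP black) (idP-admitted Q laws κ black)
    ; hasPairBW    = release (pairP black white) (pairP-admitted Q laws κ black)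
    ; hasPairWB    = release (pairP white black) (pairP-admitted Q laws κ white)
    ; tensorClosed = λ p q Rp Rq → release (p ⊗ q) (tensor-admitted Q laws κ p q (admit p Rp) (admit q Rq))
    ; involClosed  = λ p Rp → release (p *) (invol-admitted Q laws κ p (admit p Rp))
    ; compClosed   = λ p q r composable composition Rp Rq →
        release r (comp-admitted Q laws κ p q r composable composition (admit p Rp) (admit q Rq))
    }

  -- If all blocks have size two, `fourP` is excluded by its block of size four; for the other sizes
  -- `singP` belongs to the category.
  nonHyperoctahedral : ∀ {κ′} → κ ≡ κ′ → SizeLaws Q κ′ → NonHyperoctahedral (R Q)
  nonHyperoctahedral refl (exactlyTwo two _ _ _) = inj₂ λ { (F , _) → contradiction (two (F (inj₁ zero))) λ () }
  nonHyperoctahedral refl (atMostTwo _ _ _ _ _ _ _) = inj₁ (release singP (singP-admitted Q laws κ λ ()))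
  nonHyperoctahedral refl (arbitrary _ _ _ _) = inj₁ (release singP (singP-admitted Q laws κ λ ()))

  isNonHyperoctahedralCategory : IsNonHyperoctahedralCategory (R Q)
  isNonHyperoctahedralCategory = isCategory , nonHyperoctahedral refl sizeLaws

-- The fourteen tuples

record Subgroup (G : ℤ → Set) : Set where
  field
    has-0 : G 0ℤ
    has-+ : ∀ {a b} → G a → G b → G (a ℤ.+ b)
    has-neg : ∀ {a} → G a → G (- a)

record Periodic (G X : ℤ → Set) : Set where
  field
    absorb : ∀ {a b} → X a → G b → X (a ℤ.+ b)
open Periodic

-- If `a + b` were in `A`, then absorbing `- b` would put `a` there too.
compl-periodic : ∀ {G A} → Subgroup G → Periodic G A → Periodic G (compl A)
compl-periodic {G} {A} subgroup periodic .absorb {a} {b} ¬Aa Gb Aa+b =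
  ¬Aa (subst A (cancel a b) (absorb periodic Aa+b (Subgroup.has-neg subgroup Gb)))
  where
  cancel : ∀ a b → (a ℤ.+ b) ℤ.+ - b ≡ a
  cancel = solve-∀

module _ {f : ℕ → Set} {v s k x : ℤ → Set} (S : Subgroup s) (K : Subgroup k)
         (s⊆k : ∀ {a} → s a → k a) (periodic : Periodic k x) where
  private
    module S = Subgroup S
    module K = Subgroup K

  laws-l≡k : Laws (mkT f v s k k x)
  laws-l≡k = record
    { s-0 = S.has-0 ; s-+ = S.has-+ ; s-neg = S.has-neg ; s⇒k = s⊆k
    ; k+k = K.has-+ ; k-neg = K.has-neg ; l+k = K.has-+ ; l+l = K.has-+ ; x+k = absorb periodic ; x+l = absorb periodic }

  laws-l≡∅ : Laws (mkT f v s noneℤ k x)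
  laws-l≡∅ = record
    { s-0 = S.has-0 ; s-+ = S.has-+ ; s-neg = S.has-neg ; s⇒k = s⊆k
    ; k+k = K.has-+ ; k-neg = K.has-neg ; l+k = λ () ; l+l = λ () ; x+k = absorb periodic ; x+l = λ _ () }

multiples : ∀ a → Subgroup (aℤ a)
multiples a = record
  { has-0 = 0ℤ , sym (ℤₚ.*-zeroʳ a)
  ; has-+ = λ { (t , refl) (t′ , refl) → t ℤ.+ t′ , sym (ℤₚ.*-distribˡ-+ a t t′) }
  ; has-neg = λ { (t , refl) → - t , ℤₚ.neg-distribʳ-* a t }
  }

trivial : Subgroup zeroℤ
trivial = record
  { has-0 = refl ; has-+ = λ { refl refl → refl } ; has-neg = λ { refl → refl } }

trivial-periodic : ∀ A → Periodic zeroℤ A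
trivial-periodic A .absorb {a} Aa refl = subst A (sym (ℤₚ.+-identityʳ a)) Aa

multiples-⊆ : ∀ c a {z} → aℤ (c ℤ.* a) z → aℤ a z
multiples-⊆ c a (t , refl) = c ℤ.* t , regroup c a t
  where
  regroup : ∀ c a t → (c ℤ.* a) ℤ.* t ≡ a ℤ.* (c ℤ.* t)
  regroup = solve-∀

module _ (m : ℕ) where

  um⊆m : ∀ u {z} → aℤ (+ (u ℕ.* m)) z → aℤ (+ m) z
  um⊆m u {z} = multiples-⊆ (+ u) (+ m) ∘ subst (λ a → aℤ a z) (ℤₚ.pos-* u m)

  2um⊆2m : ∀ u {z} → aℤ (+ (2 ℕ.* u ℕ.* m)) z → aℤ (+ (2 ℕ.* m)) z
  2um⊆2m u {z} = multiples-⊆ (+ u) (+ (2 ℕ.* m)) ∘ subst (λ a → aℤ a z)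
    (trans (cong +_ (trans (cong (ℕ._* m) (ℕₚ.*-comm 2 u)) (ℕₚ.*-assoc u 2 m))) (ℤₚ.pos-* u (2 ℕ.* m)))

  m-coset⊆m : ∀ {z} → shiftℤ (+ m) (+ (2 ℕ.* m)) z → aℤ (+ m) z
  m-coset⊆m (t , refl) = 1ℤ ℤ.+ (+ 2) ℤ.* t ,
    trans (cong (λ a → + m ℤ.+ a ℤ.* t) (ℤₚ.pos-* 2 m)) (regroup (+ m) t)
    where
    regroup : ∀ a t → a ℤ.+ ((+ 2) ℤ.* a) ℤ.* t ≡ a ℤ.* (1ℤ ℤ.+ (+ 2) ℤ.* t)
    regroup = solve-∀

  coset-+ : ∀ d a t t′ → (d ℤ.+ a ℤ.* t) ℤ.+ a ℤ.* t′ ≡ d ℤ.+ a ℤ.* (t ℤ.+ t′)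
  coset-+ = solve-∀

  Dm-periodic : ∀ D → Periodic (aℤ (+ m)) (Dm m D)
  Dm-periodic D .absorb (d , d∈ , t , inj₁ refl) (t′ , refl) =
    d , d∈ , t ℤ.+ t′ , inj₁ (coset-+ (+ d) (+ m) t t′)
  Dm-periodic D .absorb (d , d∈ , t , inj₂ refl) (t′ , refl) =
    d , d∈ , t ℤ.+ t′ , inj₂ (coset-+ (+ m ℤ.- + d) (+ m) t t′)

  -- `l` and `k` are the odd and the even multiples of `m`, so they add by parity. Both consist of
  -- multiples of `m`, which is why `x` only has to be periodic modulo `m`.
  laws-coset : ∀ {f v s x} → Subgroup s → (∀ {a} → s a → aℤ (+ (2 ℕ.* m)) a) → Periodic (aℤ (+ m)) x →
               Laws (mkT f v s (shiftℤ (+ m) (+ (2 ℕ.* m))) (aℤ (+ (2 ℕ.* m))) x)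
  laws-coset S s⊆k periodic = record
    { s-0 = S.has-0 ; s-+ = S.has-+ ; s-neg = S.has-neg ; s⇒k = s⊆k
    ; k+k = K.has-+ ; k-neg = K.has-neg
    ; l+k = λ { (t , refl) (t′ , refl) → t ℤ.+ t′ , coset-+ (+ m) (+ (2 ℕ.* m)) t t′ }
    -- The two representatives `m` add up to one further multiple of `2m`, whence the 1.
    ; l+l = λ { (t , refl) (t′ , refl) → 1ℤ ℤ.+ (t ℤ.+ t′) ,
        subst (λ a → (+ m ℤ.+ a ℤ.* t) ℤ.+ (+ m ℤ.+ a ℤ.* t′) ≡ a ℤ.* (1ℤ ℤ.+ (t ℤ.+ t′)))
          (sym (ℤₚ.pos-* 2 m)) (double (+ m) t t′) }
    ; x+k = λ xa ka → absorb periodic xa (um⊆m 2 ka)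
    ; x+l = λ xa la → absorb periodic xa (m-coset⊆m la)
    }
    where
    module S = Subgroup S
    module K = Subgroup (multiples (+ (2 ℕ.* m)))
    double : ∀ b t t′ → (b ℤ.+ ((+ 2) ℤ.* b) ℤ.* t) ℤ.+ (b ℤ.+ ((+ 2) ℤ.* b) ℤ.* t′) ≡
             ((+ 2) ℤ.* b) ℤ.* (1ℤ ℤ.+ (t ℤ.+ t′))
    double = solve-∀

size-pm02 : ∀ {s l k x} → SizeLaws (mkT only2 pm02 s l k x) exactlyTwo
size-pm02 = exactlyTwo id refl (inj₁ refl) (λ _ → inj₂ (inj₁ refl) , inj₂ (inj₂ refl))

size-neutral : ∀ {s k x} → SizeLaws (mkT only2 zeroℤ s noneℤ k x) exactlyTwo
size-neutral = exactlyTwo id refl refl (λ ())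

size-pm012 : ∀ {s l k x} → SizeLaws (mkT one2 pm012 s l k x) atMostTwo
size-pm012 = atMostTwo id (inj₁ refl) (inj₂ refl) (inj₁ refl) (inj₂ (inj₁ refl)) (inj₂ (inj₂ (inj₁ refl)))
  (λ _ → inj₂ (inj₂ (inj₂ (inj₁ refl))) , inj₂ (inj₂ (inj₂ (inj₂ refl))))

size-pm01 : ∀ {s k x} → SizeLaws (mkT one2 pm01 s noneℤ k x) atMostTwo
size-pm01 = atMostTwo id (inj₁ refl) (inj₂ refl) (inj₁ refl) (inj₂ (inj₁ refl)) (inj₂ (inj₂ refl)) (λ ())

size-arbitrary : ∀ {s k x} → SizeLaws (mkT posℕ allℤ s k k x) arbitrary
size-arbitrary = arbitrary id (λ _ → tt) id id

theorem6p16 : (u m : ℕ) → 1 ≤ m →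
    (D : ℕ → Set) → (∀ d → D d → d ≤ m / 2) →
    (E : ℕ → Set) →
    (N : ℕ → Set) → (∀ n → N n → 1 ≤ n) → (∀ a b → N a → N b → N (a + b)) →
    (i : Fin 14) → IsNonHyperoctahedralCategory (R (tuples u m D E N i))
theorem6p16 u m _ D _ E N _ _ = category
  where
  2um um mℤ : Subgroup _
  2um = multiples (+ (2 ℕ.* u ℕ.* m))
  um  = multiples (+ (u ℕ.* m))
  mℤ  = multiples (+ m)

  all-periodic : ∀ {G} → Periodic G allℤ
  all-periodic .absorb _ _ = tt

  self-periodic : Periodic (aℤ (+ m)) (aℤ (+ m))
  self-periodic .absorb = Subgroup.has-+ mℤ

  D-periodic : Periodic (aℤ (+ m)) (compl (Dm m D))
  D-periodic = compl-periodic mℤ (Dm-periodic m D)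

  category : (i : Fin 14) → IsNonHyperoctahedralCategory (R (tuples u m D E N i))
  -- The factor `2um` is read as the multiple `2u` of `m`.
  category zero = isNonHyperoctahedralCategory (laws-l≡k 2um mℤ (um⊆m m (2 ℕ.* u)) all-periodic) size-pm02
  category (suc zero) =
    isNonHyperoctahedralCategory (laws-coset m 2um (2um⊆2m m u) all-periodic) size-pm02
  category (suc (suc zero)) =
    isNonHyperoctahedralCategory
      (laws-coset m 2um (2um⊆2m m u) (compl-periodic mℤ self-periodic)) size-pm02
  category (suc (suc (suc zero))) =
    isNonHyperoctahedralCategory (laws-l≡∅ trivial mℤ (λ { refl → Subgroup.has-0 mℤ }) all-periodic) size-neutral
  category (suc (suc (suc (suc zero)))) =
    isNonHyperoctahedralCategory (laws-l≡k trivial trivial id (trivial-periodic (compl (pmSet N)))) size-pm02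
  category (suc (suc (suc (suc (suc zero))))) =
    isNonHyperoctahedralCategory (laws-l≡∅ trivial trivial id (trivial-periodic (compl (pmSet N)))) size-neutral
  category (suc (suc (suc (suc (suc (suc zero)))))) =
    isNonHyperoctahedralCategory (laws-l≡∅ trivial trivial id (trivial-periodic (compl (pmSet' N)))) size-neutral
  category (suc (suc (suc (suc (suc (suc (suc zero))))))) =
    isNonHyperoctahedralCategory (laws-l≡k um mℤ (um⊆m m u) D-periodic) size-pm012
  category (suc (suc (suc (suc (suc (suc (suc (suc zero)))))))) =
    isNonHyperoctahedralCategory (laws-coset m 2um (2um⊆2m m u) D-periodic) size-pm012
  category (suc (suc (suc (suc (suc (suc (suc (suc (suc zero))))))))) =
    isNonHyperoctahedralCategory (laws-l≡∅ um mℤ (um⊆m m u) D-periodic) size-pm01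
  category (suc (suc (suc (suc (suc (suc (suc (suc (suc (suc zero)))))))))) =
    isNonHyperoctahedralCategory (laws-l≡k trivial trivial id (trivial-periodic (compl (pmSet E)))) size-pm012
  category (suc (suc (suc (suc (suc (suc (suc (suc (suc (suc (suc zero))))))))))) =
    isNonHyperoctahedralCategory (laws-l≡∅ trivial trivial id (trivial-periodic (compl (pmSet E)))) size-pm01
  category (suc (suc (suc (suc (suc (suc (suc (suc (suc (suc (suc (suc zero)))))))))))) =
    isNonHyperoctahedralCategory (laws-l≡k um mℤ (um⊆m m u) D-periodic) size-arbitrary
  category (suc (suc (suc (suc (suc (suc (suc (suc (suc (suc (suc (suc (suc zero))))))))))))) =
    isNonHyperoctahedralCategory (laws-l≡k trivial trivial id (trivial-periodic (compl (pmSet E)))) size-arbitrary
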